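{- Let $p$ be a prime number and let $a$ be an integer that is not a multiple of $p$. Then for every positive integer $n$, $$\vartheta_p\left(\sum_{k=1}^{n}\left(\frac{1}{a^k}+\frac{1}{(p-a)^k}\right)\frac{p^k}{k}\right) \geq (n+1) - \log_p\left(\frac{n+1}{2}\right).$$ Moreover, this inequality is an equality if and only if $n = 2p^{\alpha}-1$ for some non-negative integer $\alpha$.
   Context: For a prime $p$ and a nonzero rational number $r$, $\vartheta_p(r)$ denotes the $p$-adic valuation of $r$. For a positive real $x$, $\log_p(x) = \frac{\log x}{\log p}$ is the logarithm to base $p$. -}

module Defs where

open import Data.Nat as ℕ using (ℕ; zero; suc)
open import Data.Nat.Divisibility using (_∣_)
open import Data.Integer as ℤ using (ℤ; +_; -[1+_]; ∣_∣)
open import Data.Rational using (ℚ; 0ℚ; 1ℚ; _/_; 1/_; ≢-nonZero)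
  renaming (_+_ to _+ℚ_; _*_ to _*ℚ_)
open import Data.Rational.Properties using (_≟_)
open import Data.Product using (Σ; _×_)
open import Relation.Nullary using (¬_; yes; no)
open import Relation.Binary.PropositionalEquality using (_≡_)

fromℤ : ℤ → ℚ
fromℤ z = z / 1

-- total multiplicative inverse (1/0 := 0); only ever applied to nonzero arguments here
inv : ℚ → ℚ
inv q with q ≟ 0ℚ
... | yes _ = 0ℚ
... | no q≢0 = 1/_ q {{≢-nonZero q≢0}}

_^ℚ_ : ℚ → ℕ → ℚ
q ^ℚ zero = 1ℚ
q ^ℚ suc k = q *ℚ (q ^ℚ k)

_^ℤ_ : ℚ → ℤ → ℚ
q ^ℤ (+ k) = q ^ℚ k
q ^ℤ -[1+ k ] = inv (q ^ℚ suc k)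

-- p-adic valuation of a rational r, as a relation:
-- PadicVal p r v  iff  r = p^v · (u / w) with p ∤ u, p ∤ w (w ≥ 1).
-- For prime p and r ≠ 0 such v exists and is unique (= ϑ_p(r)); for r = 0 there is none.
PadicVal : ℕ → ℚ → ℤ → Set
PadicVal p r v =
  Σ ℤ λ u → Σ ℕ λ w →
    ¬ (p ∣ ∣ u ∣) × ¬ (p ∣ suc w) × (r ≡ (fromℤ (+ p) ^ℤ v) *ℚ (u / suc w))

-- the k-th summand, k = suc j:  (1/a^k + 1/(p-a)^k) · p^k / k
term : ℕ → ℤ → ℕ → ℚ
term p a j =
  (inv (fromℤ (a ℤ.^ suc j)) +ℚ inv (fromℤ ((+ p ℤ.- a) ℤ.^ suc j)))
    *ℚ ((+ (p ℕ.^ suc j)) / suc j)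

S : ℕ → ℤ → ℕ → ℚ
S p a zero = 0ℚ
S p a (suc n) = S p a n +ℚ term p a n

{-# OPTIONS --safe #-}

-- Put b = p - a, x = -p/a, y = -p/b. Then x + y = -x y =: w = -p²/(a b), so Σ (xᵏ + yᵏ)/k · tᵏ = -log (1 - w (t + t²)),
-- and dividing by 1 + t gives the generating function of (-1)ⁿ S_n. This yields the finite closed form
--   S_n = (-1)ⁿ Σ_i C(i - 1 , n - i) wⁱ / i,
-- in which only i ≥ (n + 1)/2 occur and the i-th summand has valuation at least 2i - ϑ_p(i) ≥ 2i - log_p i.
-- This bound is increasing in i, and at the smallest possible i = (n + 1)/2 the binomial coefficient is 1, which gives the equality case.
-- If a b < 0 then w > 0 and all summands are nonnegative, while for a, b > 0 the original sum has positive terms; so S_n ≠ 0.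
module Submission where

open import Defs
open import Data.Nat as ℕ using (ℕ; zero; suc; _≤_)
import Data.Nat.Properties as ℕ
import Data.Nat.Tactic.RingSolver as ℕ-Solver
open import Data.Nat.Divisibility using (_∣_; _∣?_; divides; ∣1⇒≡1; m∣m*n)
open import Data.Nat.Induction using (<-rec)
open import Data.Nat.Primality using (Prime; euclidsLemma; ¬prime[1]; prime⇒nonZero; prime⇒nonTrivial)
open import Data.Integer as ℤ using (ℤ; +_; -[1+_]; ∣_∣)
import Data.Integer.Properties as ℤ
import Data.Integer.Tactic.RingSolver as ℤ-Solver
open import Data.Integer.Divisibility using () renaming (_∣_ to _∣ℤ_)
import Data.Integer.Divisibility.Signed as Signed
open import Data.Rational using (ℚ; 0ℚ; 1ℚ; _/_; _+_; _*_; -_) renaming (_≤_ to _≤ℚ_; _<_ to _<ℚ_)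
open import Data.Rational.Base using (mkℚ; toℚᵘ; ≢-nonZero; positive; nonNegative)
import Data.Rational.Properties as ℚ
open import Data.Rational.Unnormalised.Base using (mkℚᵘ; *≡*; *<*; *≤*) renaming (_≃_ to _≃ᵘ_)
import Data.Rational.Unnormalised as ℚᵘ
import Data.Rational.Unnormalised.Properties as ℚᵘ
open import Data.Maybe using (just; nothing)
open import Data.Product using (Σ; ∃; _×_; _,_)
open import Data.Sum using (inj₁; inj₂)
open import Function.Bundles using (_⇔_; mk⇔)
open import Tactic.RingSolver using (solve-∀)
import Tactic.RingSolver.Core.AlmostCommutativeRing as ACR
open import Relation.Binary.Definitions using (Tri; tri<; tri≈; tri>)
open import Relation.Nullary using (¬_; yes; no; contradiction)
open import Relation.Binary.PropositionalEquality using (_≡_; _≢_; refl; sym; trans; cong; cong₂; subst; subst₂; module ≡-Reasoning)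

-- The minus signs in x and y are there for positivity of coefficients: p/a and p/b themselves would
-- give 1 - (p²/(a b)) (t - t²), whose expansion alternates. Division by 1 + t is the source of the
-- constant 2. Since t + t² = t (1 + t), the quotient of (t + t²)ⁱ is t (t + t²)ⁱ⁻¹, a polynomial of
-- degree 2i - 1, so tⁿ occurs only if 2i ≥ n + 1. No power series are formed. The logarithm enters
-- through its derivative, that is, through a Waring formula for xᵏ + yᵏ, and the factor 1 + t
-- becomes a relation between consecutive coefficients. Logarithms to base p are exponentiated: with
-- v the valuation of S_n, the claim reads p^(n + 1 - v) ≤ (n + 1)/2. In the estimates log_p ((n +
-- 1)/2) is replaced by its integer part α, given by 2 p^α ≤ n + 1 < 2 p^(α + 1); as v is an
-- integer, v ≥ n + 1 - α is equally strong. Below, n is `suc m`, n + 1 is `M`, and the i of the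
-- overview is `suc i`.

ℚ-ring : ACR.AlmostCommutativeRing _ _
ℚ-ring = ACR.fromCommutativeRing ℚ.+-*-commutativeRing λ { (mkℚ (+ 0) 0 _) → just refl ; _ → nothing }

-- Integers and powers inside the rationals

toℚᵘ-fromℤ : ∀ z → toℚᵘ (fromℤ z) ≃ᵘ mkℚᵘ z 0
toℚᵘ-fromℤ z = ℚ.toℚᵘ-fromℚᵘ (mkℚᵘ z 0)

fromℤ-injective : ∀ {y z} → fromℤ y ≡ fromℤ z → y ≡ z
fromℤ-injective {y} {z} eq with ℚ.fromℚᵘ-injective {mkℚᵘ y 0} {mkℚᵘ z 0} eq
... | *≡* eq′ = trans (sym (ℤ.*-identityʳ y)) (trans eq′ (ℤ.*-identityʳ z))

fromℤ-+ : ∀ y z → fromℤ (y ℤ.+ z) ≡ fromℤ y + fromℤ z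
fromℤ-+ y z = ℚ.toℚᵘ-injective (begin
  toℚᵘ (fromℤ (y ℤ.+ z))                       ≈⟨ toℚᵘ-fromℤ (y ℤ.+ z) ⟩
  mkℚᵘ (y ℤ.+ z) 0                             ≈⟨ *≡* (lemma y z) ⟩
  mkℚᵘ y 0 ℚᵘ.+ mkℚᵘ z 0                       ≈⟨ ℚᵘ.+-cong (toℚᵘ-fromℤ y) (toℚᵘ-fromℤ z) ⟨
  toℚᵘ (fromℤ y) ℚᵘ.+ toℚᵘ (fromℤ z)           ≈⟨ ℚ.toℚᵘ-homo-+ (fromℤ y) (fromℤ z) ⟨
  toℚᵘ (fromℤ y + fromℤ z)                     ∎)
  where
  open ℚᵘ.≃-Reasoning
  lemma : ∀ y z → (y ℤ.+ z) ℤ.* + 1 ≡ (y ℤ.* + 1 ℤ.+ z ℤ.* + 1) ℤ.* + 1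
  lemma = ℤ-Solver.solve-∀

fromℤ-* : ∀ y z → fromℤ (y ℤ.* z) ≡ fromℤ y * fromℤ z
fromℤ-* y z = ℚ.toℚᵘ-injective (begin
  toℚᵘ (fromℤ (y ℤ.* z))                       ≈⟨ toℚᵘ-fromℤ (y ℤ.* z) ⟩
  mkℚᵘ y 0 ℚᵘ.* mkℚᵘ z 0                       ≈⟨ ℚᵘ.*-cong (toℚᵘ-fromℤ y) (toℚᵘ-fromℤ z) ⟨
  toℚᵘ (fromℤ y) ℚᵘ.* toℚᵘ (fromℤ z)           ≈⟨ ℚ.toℚᵘ-homo-* (fromℤ y) (fromℤ z) ⟨
  toℚᵘ (fromℤ y * fromℤ z)                     ∎)
  where open ℚᵘ.≃-Reasoning

fromℤ-^ : ∀ z k → fromℤ (z ℤ.^ k) ≡ fromℤ z ^ℚ k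
fromℤ-^ z zero    = refl
fromℤ-^ z (suc k) = trans (fromℤ-* z (z ℤ.^ k)) (cong (fromℤ z *_) (fromℤ-^ z k))

fromℤ-pos-^ : ∀ m k → fromℤ (+ (m ℕ.^ k)) ≡ fromℤ (+ m) ^ℚ k
fromℤ-pos-^ m zero    = refl
fromℤ-pos-^ m (suc k) = begin
  fromℤ (+ (m ℕ.* m ℕ.^ k))              ≡⟨ cong fromℤ (ℤ.pos-* m (m ℕ.^ k)) ⟩
  fromℤ (+ m ℤ.* + (m ℕ.^ k))            ≡⟨ fromℤ-* (+ m) (+ (m ℕ.^ k)) ⟩
  fromℤ (+ m) * fromℤ (+ (m ℕ.^ k))      ≡⟨ cong (fromℤ (+ m) *_) (fromℤ-pos-^ m k) ⟩
  fromℤ (+ m) * fromℤ (+ m) ^ℚ k         ∎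
  where open ≡-Reasoning

/-fromℤ : ∀ z d .{{_ : ℕ.NonZero d}} → (z / d) * fromℤ (+ d) ≡ fromℤ z
/-fromℤ z d@(suc d-1) = ℚ.toℚᵘ-injective (begin
  toℚᵘ ((z / d) * fromℤ (+ d))              ≈⟨ ℚ.toℚᵘ-homo-* (z / d) (fromℤ (+ d)) ⟩
  toℚᵘ (z / d) ℚᵘ.* toℚᵘ (fromℤ (+ d))      ≈⟨ ℚᵘ.*-cong (ℚ.toℚᵘ-fromℚᵘ (mkℚᵘ z d-1)) (toℚᵘ-fromℤ (+ d)) ⟩
  mkℚᵘ z d-1 ℚᵘ.* mkℚᵘ (+ d) 0              ≈⟨ *≡* (lemma z (+ d)) ⟩
  mkℚᵘ z 0                                  ≈⟨ toℚᵘ-fromℤ z ⟨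
  toℚᵘ (fromℤ z)                            ∎)
  where
  open ℚᵘ.≃-Reasoning
  lemma : ∀ y c → (y ℤ.* c) ℤ.* + 1 ≡ y ℤ.* (c ℤ.* + 1)
  lemma = ℤ-Solver.solve-∀

fromℤ-mono-< : ∀ {y z} → y ℤ.< z → fromℤ y <ℚ fromℤ z
fromℤ-mono-< {y} {z} y<z = ℚ.toℚᵘ-cancel-< (begin-strict
  toℚᵘ (fromℤ y)  ≃⟨ toℚᵘ-fromℤ y ⟩
  mkℚᵘ y 0        <⟨ *<* (ℤ.*-monoʳ-<-pos (+ 1) y<z) ⟩
  mkℚᵘ z 0        ≃⟨ toℚᵘ-fromℤ z ⟨
  toℚᵘ (fromℤ z)  ∎)
  where open ℚᵘ.≤-Reasoning

fromℤ-mono-≤ : ∀ {y z} → y ℤ.≤ z → fromℤ y ≤ℚ fromℤ z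
fromℤ-mono-≤ {y} {z} y≤z = ℚ.toℚᵘ-cancel-≤ (begin
  toℚᵘ (fromℤ y)  ≃⟨ toℚᵘ-fromℤ y ⟩
  mkℚᵘ y 0        ≤⟨ *≤* (ℤ.*-monoʳ-≤-nonNeg (+ 1) y≤z) ⟩
  mkℚᵘ z 0        ≃⟨ toℚᵘ-fromℤ z ⟨
  toℚᵘ (fromℤ z)  ∎)
  where open ℚᵘ.≤-Reasoning

*-pos : ∀ {q r} → 0ℚ <ℚ q → 0ℚ <ℚ r → 0ℚ <ℚ q * r
*-pos {q} {r} 0<q 0<r = ℚ.positive⁻¹ (q * r) {{ℚ.pos*pos⇒pos q {{positive 0<q}} r {{positive 0<r}}}}

inv-inverseʳ : ∀ {q} → q ≢ 0ℚ → q * inv q ≡ 1ℚ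
inv-inverseʳ {q} q≢0 with q ℚ.≟ 0ℚ
... | yes q≡0  = contradiction q≡0 q≢0
... | no  q≢0′ = ℚ.*-inverseʳ q {{≢-nonZero q≢0′}}

*-cancelˡ : ∀ {r p q} → r ≢ 0ℚ → r * p ≡ r * q → p ≡ q
*-cancelˡ {r} {p} {q} r≢0 eq = begin
  p                ≡⟨ expand p ⟩
  inv r * (r * p)  ≡⟨ cong (inv r *_) eq ⟩
  inv r * (r * q)  ≡⟨ expand q ⟨
  q                ∎
  where
  open ≡-Reasoning
  reassoc : ∀ r i p → (r * i) * p ≡ i * (r * p)
  reassoc = solve-∀ ℚ-ring
  expand : ∀ p → p ≡ inv r * (r * p)
  expand p = begin
    p                ≡⟨ ℚ.*-identityˡ p ⟨
    1ℚ * p           ≡⟨ cong (_* p) (inv-inverseʳ r≢0) ⟨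
    (r * inv r) * p  ≡⟨ reassoc r (inv r) p ⟩
    inv r * (r * p)  ∎

inv-unique : ∀ {q r} → q * r ≡ 1ℚ → inv q ≡ r
inv-unique {q} {r} qr≡1 = *-cancelˡ q≢0 (trans (inv-inverseʳ q≢0) (sym qr≡1))
  where
  q≢0 : q ≢ 0ℚ
  q≢0 refl = contradiction (trans (sym qr≡1) (ℚ.*-zeroˡ r)) λ ()

^ℚ-distribʳ-* : ∀ q r k → (q * r) ^ℚ k ≡ q ^ℚ k * r ^ℚ k
^ℚ-distribʳ-* q r zero    = refl
^ℚ-distribʳ-* q r (suc k) = trans (cong (q * r *_) (^ℚ-distribʳ-* q r k)) (interchange q r (q ^ℚ k) (r ^ℚ k))
  where
  interchange : ∀ a b c d → a * b * (c * d) ≡ a * c * (b * d)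
  interchange = solve-∀ ℚ-ring

1^ℚ : ∀ k → 1ℚ ^ℚ k ≡ 1ℚ
1^ℚ zero    = refl
1^ℚ (suc k) = trans (ℚ.*-identityˡ (1ℚ ^ℚ k)) (1^ℚ k)

inv-^ : ∀ {q} → q ≢ 0ℚ → ∀ k → inv (q ^ℚ k) ≡ inv q ^ℚ k
inv-^ {q} q≢0 k = inv-unique {q ^ℚ k} (begin
  q ^ℚ k * inv q ^ℚ k  ≡⟨ ^ℚ-distribʳ-* q (inv q) k ⟨
  (q * inv q) ^ℚ k     ≡⟨ cong (_^ℚ k) (inv-inverseʳ q≢0) ⟩
  1ℚ ^ℚ k              ≡⟨ 1^ℚ k ⟩
  1ℚ                   ∎)
  where open ≡-Reasoning

pos-^ℚ : ∀ {q} → 0ℚ <ℚ q → ∀ k → 0ℚ <ℚ q ^ℚ k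
pos-^ℚ 0<q zero    = fromℤ-mono-< {+ 0} {+ 1} (ℤ.+<+ (ℕ.s≤s ℕ.z≤n))
pos-^ℚ 0<q (suc k) = *-pos 0<q (pos-^ℚ 0<q k)

-- Finite sums of rationals

∑ : ℕ → (ℕ → ℚ) → ℚ
∑ zero    f = 0ℚ
∑ (suc n) f = f 0 + ∑ n (λ i → f (suc i))

∑-cong : ∀ n {f g} → (∀ i → f i ≡ g i) → ∑ n f ≡ ∑ n g
∑-cong zero    f≗g = refl
∑-cong (suc n) f≗g = cong₂ _+_ (f≗g 0) (∑-cong n (λ i → f≗g (suc i)))

∑-zero : ∀ n {f} → (∀ i → f i ≡ 0ℚ) → ∑ n f ≡ 0ℚ
∑-zero zero    f≗0 = refl
∑-zero (suc n) f≗0 = cong₂ _+_ (f≗0 0) (∑-zero n (λ i → f≗0 (suc i)))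

∑-+ : ∀ n f g → ∑ n (λ i → f i + g i) ≡ ∑ n f + ∑ n g
∑-+ zero    f g = refl
∑-+ (suc n) f g = trans (cong (λ s → f 0 + g 0 + s) (∑-+ n _ _)) (interchange (f 0) (g 0) _ _)
  where
  interchange : ∀ a b c d → a + b + (c + d) ≡ a + c + (b + d)
  interchange = solve-∀ ℚ-ring

∑-*ˡ : ∀ n c f → c * ∑ n f ≡ ∑ n (λ i → c * f i)
∑-*ˡ zero    c f = ℚ.*-zeroʳ c
∑-*ˡ (suc n) c f = trans (ℚ.*-distribˡ-+ c (f 0) _) (cong (λ s → c * f 0 + s) (∑-*ˡ n c _))

∑-last : ∀ n f → ∑ (suc n) f ≡ ∑ n f + f n
∑-last zero    f = ℚ.+-comm (f 0) 0ℚ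
∑-last (suc n) f = trans (cong (λ s → f 0 + s) (∑-last n (λ i → f (suc i)))) (sym (ℚ.+-assoc (f 0) _ _))

-- Coefficients of the powers of t + t²

-- κ i m is the coefficient of tᵐ in (t + t²)ⁱ, i.e. C(i , m - i).
κ : ℕ → ℕ → ℕ
κ zero    zero          = 1
κ zero    (suc m)       = 0
κ (suc i) zero          = 0
κ (suc i) (suc zero)    = κ i 0
κ (suc i) (suc (suc m)) = κ i (suc m) ℕ.+ κ i m

-- Every term of (t + t²)ⁱ has degree between i and 2i; `κ-high` is the other half.
κ-low : ∀ {i m} → m ℕ.< i → κ i m ≡ 0
κ-low {suc i}       {zero}        _                       = refl
κ-low {suc (suc i)} {suc zero}    _                       = refl
κ-low {suc i}       {suc (suc m)} (ℕ.s≤s m<i) =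
  cong₂ ℕ._+_ (κ-low m<i) (κ-low (ℕ.<-trans (ℕ.n<1+n m) m<i))

κ-high : ∀ {i m} → 2 ℕ.* i ℕ.< m → κ i m ≡ 0
κ-high {zero}  {suc m}       _     = refl
κ-high {suc i} {suc zero}    (ℕ.s≤s ())
κ-high {suc i} {suc (suc m)} 2i<m = cong₂ ℕ._+_ (κ-high {i} (ℕ.m<n⇒m<1+n 2i′<m)) (κ-high {i} 2i′<m)
  where
  2i′<m : 2 ℕ.* i ℕ.< m
  2i′<m = ℕ.≤-pred (ℕ.≤-pred (subst (ℕ._< suc (suc m)) (ℕ.*-suc 2 i) 2i<m))

κ-diagonal : ∀ i → κ i i ≡ 1
κ-diagonal zero          = refl
κ-diagonal (suc zero)    = refl
κ-diagonal (suc (suc i)) = cong₂ ℕ._+_ (κ-diagonal (suc i)) (κ-low (ℕ.n<1+n i))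

-- Degree 2i is reached only by choosing t² in all i factors.
κ-top : ∀ i → κ i (2 ℕ.* i) ≡ 1
κ-top zero    = refl
κ-top (suc i) rewrite ℕ.*-suc 2 i = cong₂ ℕ._+_ (κ-high {i} (ℕ.n<1+n (2 ℕ.* i))) (κ-top i)

-- Compare coefficients in t · d/dt (t + t²)ⁱ⁺¹ = (i + 1) (t + 2t²) (t + t²)ⁱ.
κ-derivative : ∀ i m → (2 ℕ.+ m) ℕ.* (κ i (suc m) ℕ.+ κ i m) ≡ suc i ℕ.* (κ i (suc m) ℕ.+ 2 ℕ.* κ i m)
κ-derivative zero zero          = refl
κ-derivative zero (suc m)       = ℕ.*-zeroʳ m
κ-derivative (suc zero)    zero = refl
κ-derivative (suc (suc i)) zero = sym (ℕ.*-zeroʳ i)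
κ-derivative (suc zero) (suc zero) = refl
κ-derivative (suc (suc i)) (suc zero) = lemma i (κ (suc i) 1) (κ-derivative (suc i) zero)
  where
  open ≡-Reasoning
  lemma : ∀ i a → 2 ℕ.* (a ℕ.+ 0) ≡ (2 ℕ.+ i) ℕ.* (a ℕ.+ 0) →
          3 ℕ.* ((a ℕ.+ 0) ℕ.+ 0) ≡ (3 ℕ.+ i) ℕ.* ((a ℕ.+ 0) ℕ.+ 0)
  lemma i a h = begin
    3 ℕ.* ((a ℕ.+ 0) ℕ.+ 0)                      ≡⟨ split a ⟩
    (a ℕ.+ 0) ℕ.+ 2 ℕ.* (a ℕ.+ 0)                ≡⟨ cong ((a ℕ.+ 0) ℕ.+_) h ⟩
    (a ℕ.+ 0) ℕ.+ (2 ℕ.+ i) ℕ.* (a ℕ.+ 0)        ≡⟨ merge i a ⟩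
    (3 ℕ.+ i) ℕ.* ((a ℕ.+ 0) ℕ.+ 0)              ∎
    where
    split : ∀ a → 3 ℕ.* ((a ℕ.+ 0) ℕ.+ 0) ≡ (a ℕ.+ 0) ℕ.+ 2 ℕ.* (a ℕ.+ 0)
    split = ℕ-Solver.solve-∀
    merge : ∀ i a → (a ℕ.+ 0) ℕ.+ (2 ℕ.+ i) ℕ.* (a ℕ.+ 0) ≡ (3 ℕ.+ i) ℕ.* ((a ℕ.+ 0) ℕ.+ 0)
    merge = ℕ-Solver.solve-∀
-- Product rule for (t + t²) · (t + t²)ⁱ⁺¹: the two induction hypotheses differentiate the second
-- factor, and the leftover `a + b + 2 (b + c)` in `split` comes from the derivative of the first.
κ-derivative (suc i) (suc (suc m)) =
  lemma i m (κ i (2 ℕ.+ m)) (κ i (suc m)) (κ i m) (κ-derivative i (suc m)) (κ-derivative i m)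
  where
  open ≡-Reasoning
  lemma : ∀ i m a b c →
    (3 ℕ.+ m) ℕ.* (a ℕ.+ b) ≡ suc i ℕ.* (a ℕ.+ 2 ℕ.* b) →
    (2 ℕ.+ m) ℕ.* (b ℕ.+ c) ≡ suc i ℕ.* (b ℕ.+ 2 ℕ.* c) →
    (4 ℕ.+ m) ℕ.* (a ℕ.+ b ℕ.+ (b ℕ.+ c)) ≡ suc (suc i) ℕ.* (a ℕ.+ b ℕ.+ 2 ℕ.* (b ℕ.+ c))
  lemma i m a b c h₁ h₂ = begin
    (4 ℕ.+ m) ℕ.* (a ℕ.+ b ℕ.+ (b ℕ.+ c))
      ≡⟨ split m a b c ⟩
    (3 ℕ.+ m) ℕ.* (a ℕ.+ b) ℕ.+ (2 ℕ.+ m) ℕ.* (b ℕ.+ c) ℕ.+ (a ℕ.+ b ℕ.+ 2 ℕ.* (b ℕ.+ c))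
      ≡⟨ cong₂ (λ s t → s ℕ.+ t ℕ.+ (a ℕ.+ b ℕ.+ 2 ℕ.* (b ℕ.+ c))) h₁ h₂ ⟩
    suc i ℕ.* (a ℕ.+ 2 ℕ.* b) ℕ.+ suc i ℕ.* (b ℕ.+ 2 ℕ.* c) ℕ.+ (a ℕ.+ b ℕ.+ 2 ℕ.* (b ℕ.+ c))
      ≡⟨ merge i a b c ⟩
    suc (suc i) ℕ.* (a ℕ.+ b ℕ.+ 2 ℕ.* (b ℕ.+ c)) ∎
    where
    split : ∀ m a b c → (4 ℕ.+ m) ℕ.* (a ℕ.+ b ℕ.+ (b ℕ.+ c)) ≡
      (3 ℕ.+ m) ℕ.* (a ℕ.+ b) ℕ.+ (2 ℕ.+ m) ℕ.* (b ℕ.+ c) ℕ.+ (a ℕ.+ b ℕ.+ 2 ℕ.* (b ℕ.+ c))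
    split = ℕ-Solver.solve-∀
    merge : ∀ i a b c → suc i ℕ.* (a ℕ.+ 2 ℕ.* b) ℕ.+ suc i ℕ.* (b ℕ.+ 2 ℕ.* c) ℕ.+ (a ℕ.+ b ℕ.+ 2 ℕ.* (b ℕ.+ c)) ≡
      suc (suc i) ℕ.* (a ℕ.+ b ℕ.+ 2 ℕ.* (b ℕ.+ c))
    merge = ℕ-Solver.solve-∀

-- The truncated logarithm and complete symmetric sums

fromℕ : ℕ → ℚ
fromℕ m = fromℤ (+ m)

fromℕ-+ : ∀ m n → fromℕ (m ℕ.+ n) ≡ fromℕ m + fromℕ n
fromℕ-+ m n = fromℤ-+ (+ m) (+ n)

fromℕ-* : ∀ m n → fromℕ (m ℕ.* n) ≡ fromℕ m * fromℕ n
fromℕ-* m n = trans (cong fromℤ (ℤ.pos-* m n)) (fromℤ-* (+ m) (+ n))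

1/suc : ℕ → ℚ
1/suc i = + 1 / suc i

fromℕ-1/suc : ∀ i → fromℕ (suc i) * 1/suc i ≡ 1ℚ
fromℕ-1/suc i = trans (ℚ.*-comm (fromℕ (suc i)) (1/suc i)) (/-fromℤ (+ 1) (suc i))

/-1/suc : ∀ z i → z / suc i ≡ fromℤ z * 1/suc i
/-1/suc z i = begin
  z / suc i                                   ≡⟨ ℚ.*-identityʳ (z / suc i) ⟨
  z / suc i * 1ℚ                              ≡⟨ cong (z / suc i *_) (fromℕ-1/suc i) ⟨
  z / suc i * (fromℕ (suc i) * 1/suc i)       ≡⟨ ℚ.*-assoc (z / suc i) (fromℕ (suc i)) (1/suc i) ⟨
  z / suc i * fromℕ (suc i) * 1/suc i         ≡⟨ cong (_* 1/suc i) (/-fromℤ z (suc i)) ⟩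
  fromℤ z * 1/suc i                           ∎
  where open ≡-Reasoning

-- Coefficient of sⁱ⁺¹ in -log (1 - w s); the shift by one keeps the denominator positive.
logTerm : ℚ → ℕ → ℚ
logTerm w i = w ^ℚ suc i * 1/suc i

-- κ i m = 0 for i > m, so in the next two sums any bound N > m gives the same value;
-- completeSum w N m is then the complete homogeneous symmetric polynomial hₘ of the roots of X² - w X - w.
partialLog : ℚ → ℕ → ℕ → ℚ
partialLog w N m = ∑ N (λ i → fromℕ (κ i m) * logTerm w i)

completeSum : ℚ → ℕ → ℕ → ℚ
completeSum w N m = ∑ N (λ i → fromℕ (κ i m) * w ^ℚ i)

completeSum-extend : ∀ w {N m} → m ℕ.< N → completeSum w (suc N) m ≡ completeSum w N m
completeSum-extend w {N} {m} m<N = begin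
  completeSum w (suc N) m                         ≡⟨ ∑-last N _ ⟩
  completeSum w N m + fromℕ (κ N m) * w ^ℚ N      ≡⟨ cong (λ c → completeSum w N m + fromℕ c * w ^ℚ N) (κ-low m<N) ⟩
  completeSum w N m + 0ℚ * w ^ℚ N                 ≡⟨ cong (λ s → completeSum w N m + s) (ℚ.*-zeroˡ (w ^ℚ N)) ⟩
  completeSum w N m + 0ℚ                          ≡⟨ ℚ.+-identityʳ (completeSum w N m) ⟩
  completeSum w N m                               ∎
  where open ≡-Reasoning

-- The coefficients of 1 / (1 - w (t + t²)) obey this recurrence. Pascal's rule for `κ` lowers i by
-- one, which frees a factor w and shortens the range of summation; `completeSum-extend` restores
-- the range.
completeSum-recurrence : ∀ w {N m} → suc (suc m) ℕ.< N →
  completeSum w N (suc (suc m)) ≡ w * (completeSum w N (suc m) + completeSum w N m)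
completeSum-recurrence w {suc N} {m} (ℕ.s≤s 1+m<N) = begin
  0ℚ * 1ℚ + ∑ N (λ i → fromℕ (κ i (suc m) ℕ.+ κ i m) * (w * w ^ℚ i))
    ≡⟨ ℚ.+-identityˡ _ ⟩
  ∑ N (λ i → fromℕ (κ i (suc m) ℕ.+ κ i m) * (w * w ^ℚ i))
    ≡⟨ ∑-cong N (λ i → trans (cong (_* (w * w ^ℚ i)) (fromℕ-+ (κ i (suc m)) (κ i m)))
                             (regroup (fromℕ (κ i (suc m))) (fromℕ (κ i m)) w (w ^ℚ i))) ⟩
  ∑ N (λ i → w * (fromℕ (κ i (suc m)) * w ^ℚ i + fromℕ (κ i m) * w ^ℚ i))
    ≡⟨ ∑-*ˡ N w _ ⟨
  w * ∑ N (λ i → fromℕ (κ i (suc m)) * w ^ℚ i + fromℕ (κ i m) * w ^ℚ i)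
    ≡⟨ cong (w *_) (∑-+ N _ _) ⟩
  w * (completeSum w N (suc m) + completeSum w N m)
    ≡⟨ cong₂ (λ s t → w * (s + t)) (completeSum-extend w 1+m<N) (completeSum-extend w (ℕ.<-trans (ℕ.n<1+n m) 1+m<N)) ⟨
  w * (completeSum w (suc N) (suc m) + completeSum w (suc N) m) ∎
  where
  open ≡-Reasoning
  regroup : ∀ c d w v → (c + d) * (w * v) ≡ w * (c * v + d * v)
  regroup = solve-∀ ℚ-ring

completeSum-0 : ∀ w N → completeSum w (suc N) 0 ≡ 1ℚ
completeSum-0 w N = cong (λ s → 1ℚ * 1ℚ + s) (∑-zero N (λ i → ℚ.*-zeroˡ (w ^ℚ suc i)))

completeSum-1 : ∀ w N → completeSum w (suc (suc N)) 1 ≡ w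
completeSum-1 w N = trans (cong (λ s → 0ℚ * 1ℚ + (1ℚ * (w * 1ℚ) + s)) (∑-zero N (λ i → ℚ.*-zeroˡ (w ^ℚ suc (suc i))))) (simplify w)
  where
  simplify : ∀ w → 0ℚ * 1ℚ + (1ℚ * (w * 1ℚ) + 0ℚ) ≡ w
  simplify = solve-∀ ℚ-ring

-- Power sums of two roots: Newton and Waring

-- Here 1 - (x + y) t + x y t² = 1 - w (t + t²).
module _ {x y w : ℚ} (x+y≡w : x + y ≡ w) (xy≡-w : x * y ≡ - w) where

  newton : ∀ m → x ^ℚ suc (suc m) + y ^ℚ suc (suc m) ≡ w * (x ^ℚ suc m + y ^ℚ suc m) + w * (x ^ℚ m + y ^ℚ m)
  newton m = begin
    x * (x * x ^ℚ m) + y * (y * y ^ℚ m)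
      ≡⟨ expand x y (x ^ℚ m) (y ^ℚ m) ⟩
    (x + y) * (x ^ℚ suc m + y ^ℚ suc m) + - (x * y) * (x ^ℚ m + y ^ℚ m)
      ≡⟨ cong₂ (λ s t → s * (x ^ℚ suc m + y ^ℚ suc m) + - t * (x ^ℚ m + y ^ℚ m)) x+y≡w xy≡-w ⟩
    w * (x ^ℚ suc m + y ^ℚ suc m) + - - w * (x ^ℚ m + y ^ℚ m)
      ≡⟨ cong (λ s → w * (x ^ℚ suc m + y ^ℚ suc m) + s * (x ^ℚ m + y ^ℚ m)) (neg-neg w) ⟩
    w * (x ^ℚ suc m + y ^ℚ suc m) + w * (x ^ℚ m + y ^ℚ m) ∎
    where
    open ≡-Reasoning
    expand : ∀ x y X Y → x * (x * X) + y * (y * Y) ≡ (x + y) * (x * X + y * Y) + - (x * y) * (X + Y)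
    expand = solve-∀ ℚ-ring
    neg-neg : ∀ w → - - w ≡ w
    neg-neg = solve-∀ ℚ-ring

  -- Both sides are the coefficient of tᵐ⁺² in t · d/dt of -log (1 - w (t + t²)), which is w (t +
  -- 2t²) / (1 - w (t + t²)). The proof lets both sides run through the same second-order
  -- recurrence, hence the two starting cases.
  waring : ∀ {N} m → suc m ℕ.< N →
    x ^ℚ suc (suc m) + y ^ℚ suc (suc m) ≡ w * (completeSum w N (suc m) + fromℕ 2 * completeSum w N m)
  waring {suc zero} zero (ℕ.s≤s ())
  waring {suc zero} (suc zero) (ℕ.s≤s ())
  waring {suc (suc N)} zero m<N = begin
    x ^ℚ 2 + y ^ℚ 2
      ≡⟨ newton 0 ⟩
    w * (x * 1ℚ + y * 1ℚ) + w * (1ℚ + 1ℚ)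
      ≡⟨ simplify x y w ⟩
    w * ((x + y) + fromℕ 2 * 1ℚ)
      ≡⟨ cong₂ (λ s t → w * (s + fromℕ 2 * t)) (trans x+y≡w (sym (completeSum-1 w N))) (sym (completeSum-0 w (suc N))) ⟩
    w * (completeSum w (suc (suc N)) 1 + fromℕ 2 * completeSum w (suc (suc N)) 0) ∎
    where
    open ≡-Reasoning
    simplify : ∀ x y w → w * (x * 1ℚ + y * 1ℚ) + w * (1ℚ + 1ℚ) ≡ w * ((x + y) + (1ℚ + 1ℚ) * 1ℚ)
    simplify = solve-∀ ℚ-ring
  -- The formula starts at the second power sum, so the first one, x + y = w, is inserted directly.
  waring {suc (suc N)} (suc zero) 2<N = begin
    x ^ℚ 3 + y ^ℚ 3
      ≡⟨ newton 1 ⟩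
    w * (x ^ℚ 2 + y ^ℚ 2) + w * (x ^ℚ 1 + y ^ℚ 1)
      ≡⟨ cong₂ (λ s t → w * s + w * t) (waring {suc (suc N)} zero (ℕ.s≤s (ℕ.s≤s ℕ.z≤n))) (trans (simplify₁ x y) x+y≡w) ⟩
    w * (w * (H 1 + fromℕ 2 * H 0)) + w * w
      ≡⟨ cong₂ (λ s t → w * (w * (s + fromℕ 2 * t)) + w * w) (completeSum-1 w N) (completeSum-0 w (suc N)) ⟩
    w * (w * (w + fromℕ 2 * 1ℚ)) + w * w
      ≡⟨ simplify₂ w ⟩
    w * (w * (w + 1ℚ) + fromℕ 2 * w)
      ≡⟨ cong₂ (λ s t → w * (w * (s + t) + fromℕ 2 * s)) (completeSum-1 w N) (completeSum-0 w (suc N)) ⟨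
    w * (w * (H 1 + H 0) + fromℕ 2 * H 1)
      ≡⟨ cong (λ s → w * (s + fromℕ 2 * H 1)) (completeSum-recurrence w 2<N) ⟨
    w * (H 2 + fromℕ 2 * H 1) ∎
    where
    open ≡-Reasoning
    H = completeSum w (suc (suc N))
    simplify₁ : ∀ x y → x * 1ℚ + y * 1ℚ ≡ x + y
    simplify₁ = solve-∀ ℚ-ring
    simplify₂ : ∀ w → w * (w * (w + (1ℚ + 1ℚ) * 1ℚ)) + w * w ≡ w * (w * (w + 1ℚ) + (1ℚ + 1ℚ) * w)
    simplify₂ = solve-∀ ℚ-ring
  waring {N} (suc (suc m)) m<N = begin
    x ^ℚ (4 ℕ.+ m) + y ^ℚ (4 ℕ.+ m)
      ≡⟨ newton (suc (suc m)) ⟩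
    w * (x ^ℚ (3 ℕ.+ m) + y ^ℚ (3 ℕ.+ m)) + w * (x ^ℚ (2 ℕ.+ m) + y ^ℚ (2 ℕ.+ m))
      ≡⟨ cong₂ (λ s t → w * s + w * t) (waring (suc m) m<N′) (waring m (ℕ.<-trans (ℕ.n<1+n _) m<N′)) ⟩
    w * (w * (H (2 ℕ.+ m) + fromℕ 2 * H (1 ℕ.+ m))) + w * (w * (H (1 ℕ.+ m) + fromℕ 2 * H m))
      ≡⟨ regroup w (H (2 ℕ.+ m)) (H (1 ℕ.+ m)) (H m) (fromℕ 2) ⟩
    w * (w * (H (2 ℕ.+ m) + H (1 ℕ.+ m)) + fromℕ 2 * (w * (H (1 ℕ.+ m) + H m)))
      ≡⟨ cong₂ (λ s t → w * (s + fromℕ 2 * t)) (completeSum-recurrence w m<N) (completeSum-recurrence w m<N′) ⟨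
    w * (H (3 ℕ.+ m) + fromℕ 2 * H (2 ℕ.+ m)) ∎
    where
    open ≡-Reasoning
    H = completeSum w N
    m<N′ : suc (suc m) ℕ.< N
    m<N′ = ℕ.<-trans (ℕ.n<1+n _) m<N
    regroup : ∀ w a b c d → w * (w * (a + d * b)) + w * (w * (b + d * c)) ≡ w * (w * (a + b) + d * (w * (b + c)))
    regroup = solve-∀ ℚ-ring

  -- With F the generating function of `partialLog`, this is the coefficient of tᵐ⁺² in (t + t²) F =
  -- -log (1 - w (t + t²)). Summand by summand, `κ-derivative` trades the denominator i + 1 for the
  -- common denominator m + 2, which leaves the sums of `waring`.
  partialLog-step : ∀ {N} m → suc m ℕ.< N →
    partialLog w N (suc m) + partialLog w N m ≡ (x ^ℚ suc (suc m) + y ^ℚ suc (suc m)) * 1/suc (suc m)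
  partialLog-step {N} m m<N = begin
    F (suc m) + F m
      ≡⟨ ∑-+ N _ _ ⟨
    ∑ N (λ i → fromℕ (κ i (suc m)) * logTerm w i + fromℕ (κ i m) * logTerm w i)
      ≡⟨ ∑-cong N summand ⟩
    ∑ N (λ i → (w * 1/suc (suc m)) * (fromℕ (κ i (suc m)) * w ^ℚ i + fromℕ 2 * (fromℕ (κ i m) * w ^ℚ i)))
      ≡⟨ ∑-*ˡ N (w * 1/suc (suc m)) _ ⟨
    (w * 1/suc (suc m)) * ∑ N (λ i → fromℕ (κ i (suc m)) * w ^ℚ i + fromℕ 2 * (fromℕ (κ i m) * w ^ℚ i))
      ≡⟨ cong (w * 1/suc (suc m) *_) (trans (∑-+ N _ _) (cong (λ s → H (suc m) + s) (sym (∑-*ˡ N (fromℕ 2) _)))) ⟩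
    (w * 1/suc (suc m)) * (H (suc m) + fromℕ 2 * H m)
      ≡⟨ swap w (1/suc (suc m)) (H (suc m) + fromℕ 2 * H m) ⟩
    (w * (H (suc m) + fromℕ 2 * H m)) * 1/suc (suc m)
      ≡⟨ cong (_* 1/suc (suc m)) (waring m m<N) ⟨
    (x ^ℚ suc (suc m) + y ^ℚ suc (suc m)) * 1/suc (suc m) ∎
    where
    open ≡-Reasoning
    H = completeSum w N
    F = partialLog w N
    swap : ∀ w r s → (w * r) * s ≡ (w * s) * r
    swap = solve-∀ ℚ-ring
    summand : ∀ i → fromℕ (κ i (suc m)) * logTerm w i + fromℕ (κ i m) * logTerm w i ≡
      (w * 1/suc (suc m)) * (fromℕ (κ i (suc m)) * w ^ℚ i + fromℕ 2 * (fromℕ (κ i m) * w ^ℚ i))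
    summand i = begin
      a * (w * v * r) + b * (w * v * r)
        ≡⟨ ℚ.*-identityˡ _ ⟨
      1ℚ * (a * (w * v * r) + b * (w * v * r))
        ≡⟨ cong (_* (a * (w * v * r) + b * (w * v * r))) (fromℕ-1/suc (suc m)) ⟨
      (c * s) * (a * (w * v * r) + b * (w * v * r))
        ≡⟨ regroup₁ c s a b w v r ⟩
      (c * (a + b)) * (s * w * v * r)
        ≡⟨ cong (_* (s * w * v * r)) derivative ⟩
      (d * (a + fromℕ 2 * b)) * (s * w * v * r)
        ≡⟨ regroup₂ d (fromℕ 2) s a b w v r ⟩
      (d * r) * ((w * s) * (a * v + fromℕ 2 * (b * v)))
        ≡⟨ cong (_* ((w * s) * (a * v + fromℕ 2 * (b * v)))) (fromℕ-1/suc i) ⟩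
      1ℚ * ((w * s) * (a * v + fromℕ 2 * (b * v)))
        ≡⟨ ℚ.*-identityˡ _ ⟩
      (w * s) * (a * v + fromℕ 2 * (b * v)) ∎
      where
      a = fromℕ (κ i (suc m))
      b = fromℕ (κ i m)
      c = fromℕ (2 ℕ.+ m)
      d = fromℕ (suc i)
      r = 1/suc i
      s = 1/suc (suc m)
      v = w ^ℚ i
      regroup₁ : ∀ c s a b w v r → (c * s) * (a * (w * v * r) + b * (w * v * r)) ≡ (c * (a + b)) * (s * w * v * r)
      regroup₁ = solve-∀ ℚ-ring
      regroup₂ : ∀ d e s a b w v r → (d * (a + e * b)) * (s * w * v * r) ≡ (d * r) * ((w * s) * (a * v + e * (b * v)))
      regroup₂ = solve-∀ ℚ-ring
      derivative : c * (a + b) ≡ d * (a + fromℕ 2 * b)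
      derivative = begin
        c * (a + b)
          ≡⟨ cong (c *_) (fromℕ-+ (κ i (suc m)) (κ i m)) ⟨
        c * fromℕ (κ i (suc m) ℕ.+ κ i m)
          ≡⟨ fromℕ-* (2 ℕ.+ m) (κ i (suc m) ℕ.+ κ i m) ⟨
        fromℕ ((2 ℕ.+ m) ℕ.* (κ i (suc m) ℕ.+ κ i m))
          ≡⟨ cong fromℕ (κ-derivative i m) ⟩
        fromℕ (suc i ℕ.* (κ i (suc m) ℕ.+ 2 ℕ.* κ i m))
          ≡⟨ fromℕ-* (suc i) (κ i (suc m) ℕ.+ 2 ℕ.* κ i m) ⟩
        d * fromℕ (κ i (suc m) ℕ.+ 2 ℕ.* κ i m)
          ≡⟨ cong (d *_) (trans (fromℕ-+ (κ i (suc m)) (2 ℕ.* κ i m)) (cong (λ t → a + t) (fromℕ-* 2 (κ i m)))) ⟩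
        d * (a + fromℕ 2 * b) ∎

  partialLog-0 : ∀ N → partialLog w (suc N) 0 ≡ x ^ℚ 1 + y ^ℚ 1
  partialLog-0 N = trans (cong (λ s → 1ℚ * ((w * 1ℚ) * 1ℚ) + s) (∑-zero N (λ i → ℚ.*-zeroˡ (logTerm w (suc i)))))
    (trans (simplify₁ w) (trans (sym x+y≡w) (simplify₂ x y)))
    where
    simplify₁ : ∀ w → 1ℚ * ((w * 1ℚ) * 1ℚ) + 0ℚ ≡ w
    simplify₁ = solve-∀ ℚ-ring
    simplify₂ : ∀ x y → x + y ≡ x * 1ℚ + y * 1ℚ
    simplify₂ = solve-∀ ℚ-ring

-- Valuations at p as cleared equations

module Valuation {p : ℕ} (p-prime : Prime p) where

  instance
    p≢0 : ℕ.NonZero p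
    p≢0 = prime⇒nonZero p-prime

  Unit : ℤ → Set
  Unit z = ¬ (p ∣ ∣ z ∣)

  unit-1 : Unit (+ 1)
  unit-1 p∣1 with ∣1⇒≡1 p∣1
  ... | refl = ¬prime[1] p-prime

  unit-* : ∀ y z → Unit y → Unit z → Unit (y ℤ.* z)
  unit-* y z p∤y p∤z p∣yz with euclidsLemma ∣ y ∣ ∣ z ∣ p-prime (subst (p ∣_) (ℤ.abs-* y z) p∣yz)
  ... | inj₁ p∣y = p∤y p∣y
  ... | inj₂ p∣z = p∤z p∣z

  unit-neg : ∀ z → Unit z → Unit (ℤ.- z)
  unit-neg z p∤z p∣-z = p∤z (subst (p ∣_) (ℤ.∣-i∣≡∣i∣ z) p∣-z)

  unit-^ : ∀ z k → Unit z → Unit (z ℤ.^ k)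
  unit-^ z zero    p∤z = unit-1
  unit-^ z (suc k) p∤z = unit-* z (z ℤ.^ k) p∤z (unit-^ z k p∤z)

  unit-+ : ∀ y z → Unit y → Unit (y ℤ.+ + p ℤ.* z)
  unit-+ y z p∤y p∣y+pz = p∤y (Signed.∣⇒∣ᵤ (Signed.∣m+n∣n⇒∣m {+ p} {y}
    (Signed.∣ᵤ⇒∣ p∣y+pz) (Signed.∣m⇒∣m*n z Signed.∣-refl)))

  infix 8 pow_
  pow_ : ℕ → ℚ
  pow e = fromℕ (p ℕ.^ e)

  pow-+ : ∀ e f → pow (e ℕ.+ f) ≡ pow e * pow f
  pow-+ e f = trans (cong fromℕ (ℕ.^-distribˡ-+-* p e f)) (fromℕ-* (p ℕ.^ e) (p ℕ.^ f))

  pow>0 : ∀ e → 0ℚ <ℚ pow e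
  pow>0 e = fromℤ-mono-< (ℤ.+<+ (ℕ.m^n>0 p e))

  pow≢0 : ∀ e → pow e ≢ 0ℚ
  pow≢0 e eq = ℚ.<⇒≢ (pow>0 e) (sym eq)

  -- If f < e, cancelling p^f leaves d as a multiple of p.
  pow-compare : ∀ {e f} c d → Unit d → pow e * fromℤ c ≡ pow f * fromℤ d → e ≤ f
  pow-compare {e} {f} c d p∤d eq with ℕ.<-≤-connex f e
  ... | inj₂ e≤f = e≤f
  ... | inj₁ f<e with ℕ.m≤n⇒∃[o]m+o≡n f<e
  ...   | g , refl = contradiction p∣d p∤d
    where
    open ≡-Reasoning
    d≡ : d ≡ + p ℤ.* (+ (p ℕ.^ g) ℤ.* c)
    d≡ = fromℤ-injective (*-cancelˡ (pow≢0 f) (begin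
      pow f * fromℤ d                                      ≡⟨ eq ⟨
      pow (suc f ℕ.+ g) * fromℤ c                          ≡⟨ cong (λ e → pow e * fromℤ c) (ℕ.+-suc f g) ⟨
      pow (f ℕ.+ suc g) * fromℤ c                          ≡⟨ cong (_* fromℤ c) (pow-+ f (suc g)) ⟩
      pow f * pow suc g * fromℤ c                          ≡⟨ cong (λ q → pow f * q * fromℤ c) (fromℕ-* p (p ℕ.^ g)) ⟩
      pow f * (fromℕ p * pow g) * fromℤ c                  ≡⟨ regroup (pow f) (fromℕ p) (pow g) (fromℤ c) ⟩
      pow f * (fromℕ p * (pow g * fromℤ c))                ≡⟨ cong (λ q → pow f * (fromℕ p * q)) (fromℤ-* (+ (p ℕ.^ g)) c) ⟨
      pow f * (fromℕ p * fromℤ (+ (p ℕ.^ g) ℤ.* c))        ≡⟨ cong (pow f *_) (fromℤ-* (+ p) (+ (p ℕ.^ g) ℤ.* c)) ⟨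
      pow f * fromℤ (+ p ℤ.* (+ (p ℕ.^ g) ℤ.* c))          ∎))
      where
      regroup : ∀ a b c d → a * (b * c) * d ≡ a * (b * (c * d))
      regroup = solve-∀ ℚ-ring
    p∣d : p ∣ ∣ d ∣
    p∣d = subst (p ∣_) (sym (trans (cong ∣_∣ d≡) (ℤ.abs-* (+ p) (+ (p ℕ.^ g) ℤ.* c)))) (m∣m*n ∣ + (p ℕ.^ g) ℤ.* c ∣)

  -- Clearing the denominator replaces negative powers and divisions by one identity with integer
  -- witnesses. The numerator is arbitrary, so 0 qualifies for every e; natural exponents suffice
  -- because every wᵗ/t is p-integral.
  record Val≥ (e : ℕ) (q : ℚ) : Set where
    constructor val≥
    field
      denominator numerator : ℤ
      denominator-unit      : Unit denominator
      cleared               : q * fromℤ denominator ≡ pow e * fromℤ numerator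

  record Val≡ (e : ℕ) (q : ℚ) : Set where
    constructor val≡
    field
      denominator numerator : ℤ
      denominator-unit      : Unit denominator
      numerator-unit        : Unit numerator
      cleared               : q * fromℤ denominator ≡ pow e * fromℤ numerator

  Val≥-0 : ∀ e → Val≥ e 0ℚ
  Val≥-0 e = val≥ (+ 1) (+ 0) unit-1 (sym (ℚ.*-zeroʳ (pow e)))

  Val≡⇒Val≥ : ∀ {e q} → Val≡ e q → Val≥ e q
  Val≡⇒Val≥ (val≡ w u p∤w _ eq) = val≥ w u p∤w eq

  Val≥-weaken : ∀ {e f q} → e ≤ f → Val≥ f q → Val≥ e q
  Val≥-weaken {e} {f} {q} e≤f (val≥ w u p∤w eq) with ℕ.m≤n⇒∃[o]m+o≡n e≤f
  ... | d , refl = val≥ w (+ (p ℕ.^ d) ℤ.* u) p∤w (begin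
    q * fromℤ w                           ≡⟨ eq ⟩
    pow (e ℕ.+ d) * fromℤ u               ≡⟨ cong (_* fromℤ u) (pow-+ e d) ⟩
    pow e * pow d * fromℤ u               ≡⟨ ℚ.*-assoc (pow e) (pow d) (fromℤ u) ⟩
    pow e * (pow d * fromℤ u)             ≡⟨ cong (pow e *_) (fromℤ-* (+ (p ℕ.^ d)) u) ⟨
    pow e * fromℤ (+ (p ℕ.^ d) ℤ.* u)     ∎)
    where open ≡-Reasoning

  sum-over-common-denominator : ∀ {e q r} w u w′ u′ →
    q * fromℤ w ≡ pow e * fromℤ u → r * fromℤ w′ ≡ pow e * fromℤ u′ →
    (q + r) * fromℤ (w ℤ.* w′) ≡ pow e * fromℤ (u ℤ.* w′ ℤ.+ u′ ℤ.* w)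
  sum-over-common-denominator {e} {q} {r} w u w′ u′ eq eq′ = begin
    (q + r) * fromℤ (w ℤ.* w′)
      ≡⟨ cong ((q + r) *_) (fromℤ-* w w′) ⟩
    (q + r) * (W * W′)
      ≡⟨ regroup₁ q r W W′ ⟩
    (q * W) * W′ + (r * W′) * W
      ≡⟨ cong₂ (λ s t → s * W′ + t * W) eq eq′ ⟩
    (pow e * U) * W′ + (pow e * U′) * W
      ≡⟨ regroup₂ (pow e) U U′ W W′ ⟩
    pow e * (U * W′ + U′ * W)
      ≡⟨ cong (pow e *_) (trans (fromℤ-+ (u ℤ.* w′) (u′ ℤ.* w)) (cong₂ _+_ (fromℤ-* u w′) (fromℤ-* u′ w))) ⟨
    pow e * fromℤ (u ℤ.* w′ ℤ.+ u′ ℤ.* w) ∎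
    where
    open ≡-Reasoning
    W = fromℤ w
    W′ = fromℤ w′
    U = fromℤ u
    U′ = fromℤ u′
    regroup₁ : ∀ q r v v′ → (q + r) * (v * v′) ≡ (q * v) * v′ + (r * v′) * v
    regroup₁ = solve-∀ ℚ-ring
    regroup₂ : ∀ s u u′ v v′ → (s * u) * v′ + (s * u′) * v ≡ s * (u * v′ + u′ * v)
    regroup₂ = solve-∀ ℚ-ring

  Val≥-+ : ∀ {e q r} → Val≥ e q → Val≥ e r → Val≥ e (q + r)
  Val≥-+ {e} {q} {r} (val≥ w u p∤w eq) (val≥ w′ u′ p∤w′ eq′) =
    val≥ (w ℤ.* w′) (u ℤ.* w′ ℤ.+ u′ ℤ.* w) (unit-* w w′ p∤w p∤w′) (sum-over-common-denominator {e} {q} {r} w u w′ u′ eq eq′)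

  -- Extracting p^e leaves the second numerator with a factor p, so the combined numerator is
  -- congruent to `u * w′` modulo p.
  Val≡-+ : ∀ {e q r} → Val≡ e q → Val≥ (suc e) r → Val≡ e (q + r)
  Val≡-+ {e} {q} {r} (val≡ w u p∤w p∤u eq) (val≥ w′ u′ p∤w′ eq′) =
    val≡ (w ℤ.* w′) (u ℤ.* w′ ℤ.+ + p ℤ.* u′ ℤ.* w) (unit-* w w′ p∤w p∤w′)
    (subst (λ z → Unit (u ℤ.* w′ ℤ.+ z)) (sym (ℤ.*-assoc (+ p) u′ w)) (unit-+ (u ℤ.* w′) (u′ ℤ.* w) (unit-* u w′ p∤u p∤w′)))
    (sum-over-common-denominator {e} {q} {r} w u w′ (+ p ℤ.* u′) eq (begin
      r * fromℤ w′                       ≡⟨ eq′ ⟩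
      pow suc e * fromℤ u′               ≡⟨ cong (_* fromℤ u′) (fromℕ-* p (p ℕ.^ e)) ⟩
      fromℕ p * pow e * fromℤ u′         ≡⟨ regroup (fromℕ p) (pow e) (fromℤ u′) ⟩
      pow e * (fromℕ p * fromℤ u′)       ≡⟨ cong (pow e *_) (fromℤ-* (+ p) u′) ⟨
      pow e * fromℤ (+ p ℤ.* u′)         ∎))
    where
    open ≡-Reasoning
    regroup : ∀ a b c → a * b * c ≡ b * (a * c)
    regroup = solve-∀ ℚ-ring

  scale-equation : ∀ {e q} c w u → q * fromℤ w ≡ pow e * fromℤ u → fromℤ c * q * fromℤ w ≡ pow e * fromℤ (c ℤ.* u)
  scale-equation {e} {q} c w u eq = begin
    fromℤ c * q * fromℤ w              ≡⟨ ℚ.*-assoc (fromℤ c) q (fromℤ w) ⟩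
    fromℤ c * (q * fromℤ w)            ≡⟨ cong (fromℤ c *_) eq ⟩
    fromℤ c * (pow e * fromℤ u)        ≡⟨ regroup (fromℤ c) (pow e) (fromℤ u) ⟩
    pow e * (fromℤ c * fromℤ u)        ≡⟨ cong (pow e *_) (fromℤ-* c u) ⟨
    pow e * fromℤ (c ℤ.* u)            ∎
    where
    open ≡-Reasoning
    regroup : ∀ a b c → a * (b * c) ≡ b * (a * c)
    regroup = solve-∀ ℚ-ring

  Val≥-scale : ∀ {e q} c → Val≥ e q → Val≥ e (fromℤ c * q)
  Val≥-scale {e} {q} c (val≥ w u p∤w eq) = val≥ w (c ℤ.* u) p∤w (scale-equation {e} {q} c w u eq)

  Val≡-scale : ∀ {e q} c → Unit c → Val≡ e q → Val≡ e (fromℤ c * q)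
  Val≡-scale {e} {q} c p∤c (val≡ w u p∤w p∤u eq) =
    val≡ w (c ℤ.* u) p∤w (unit-* c u p∤c p∤u) (scale-equation {e} {q} c w u eq)

  Val≥-∑ : ∀ {e} N {f} → (∀ i → Val≥ e (f i)) → Val≥ e (∑ N f)
  Val≥-∑ {e} zero        h = Val≥-0 e
  Val≥-∑ {e} (suc N) {f} h = Val≥-+ (h 0) (Val≥-∑ N (λ i → h (suc i)))

  Val≡-∑ : ∀ {e N f} j → j ℕ.< N → Val≡ e (f j) → (∀ i → i ≢ j → Val≥ (suc e) (f i)) → Val≡ e (∑ N f)
  Val≡-∑ {e} {suc N} {f} zero _ h others =
    Val≡-+ h (Val≥-∑ N (λ i → others (suc i) λ ()))
  Val≡-∑ {e} {suc N} {f} (suc j) (ℕ.s≤s j<N) h others =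
    subst (Val≡ e) (ℚ.+-comm _ (f 0))
      (Val≡-+ (Val≡-∑ j j<N h (λ i i≢j → others (suc i) λ eq → i≢j (ℕ.suc-injective eq))) (others 0 λ ()))

  -- Writing v as l - k with natural k and l gives one equation without `inv` for both signs of v.
  PadicVal-cleared : ∀ {q v} → PadicVal p q v →
    Σ ℕ λ k → Σ ℕ λ l → v ≡ l ℤ.⊖ k ×
      Σ ℤ λ w → Σ ℤ λ u → Unit w × Unit u × pow k * q * fromℤ w ≡ pow l * fromℤ u
  PadicVal-cleared {q} {+ l} (u , w , p∤u , p∤w , eq) =
    0 , l , refl , + suc w , u , p∤w , p∤u , (begin
      1ℚ * q * fromℤ (+ suc w)                        ≡⟨ cong (_* fromℤ (+ suc w)) (ℚ.*-identityˡ q) ⟩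
      q * fromℤ (+ suc w)                             ≡⟨ cong (_* fromℤ (+ suc w)) eq ⟩
      fromℕ p ^ℚ l * (u / suc w) * fromℤ (+ suc w)    ≡⟨ ℚ.*-assoc (fromℕ p ^ℚ l) (u / suc w) (fromℤ (+ suc w)) ⟩
      fromℕ p ^ℚ l * (u / suc w * fromℤ (+ suc w))    ≡⟨ cong₂ _*_ (sym (fromℤ-pos-^ p l)) (/-fromℤ u (suc w)) ⟩
      pow l * fromℤ u                                 ∎)
    where open ≡-Reasoning
  PadicVal-cleared {q} { -[1+ k ]} (u , w , p∤u , p∤w , eq) =
    suc k , 0 , refl , + suc w , u , p∤w , p∤u , (begin
      pow suc k * q * fromℤ (+ suc w)
        ≡⟨ cong (λ r → pow suc k * r * fromℤ (+ suc w)) eq ⟩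
      pow suc k * (inv (fromℕ p ^ℚ suc k) * (u / suc w)) * fromℤ (+ suc w)
        ≡⟨ cong (λ r → pow suc k * (inv r * (u / suc w)) * fromℤ (+ suc w)) (fromℤ-pos-^ p (suc k)) ⟨
      pow suc k * (inv (pow suc k) * (u / suc w)) * fromℤ (+ suc w)
        ≡⟨ regroup (pow suc k) (inv (pow suc k)) (u / suc w) (fromℤ (+ suc w)) ⟩
      (pow suc k * inv (pow suc k)) * (u / suc w * fromℤ (+ suc w))
        ≡⟨ cong₂ _*_ (inv-inverseʳ (pow≢0 (suc k))) (/-fromℤ u (suc w)) ⟩
      1ℚ * fromℤ u ∎)
    where
    open ≡-Reasoning
    regroup : ∀ a b c d → a * (b * c) * d ≡ (a * b) * (c * d)
    regroup = solve-∀ ℚ-ring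

  module _ {q : ℚ} (k l : ℕ) (w u : ℤ) (p∤w : Unit w) (p∤u : Unit u)
           (eq : pow k * q * fromℤ w ≡ pow l * fromℤ u) where

    -- Two descriptions of q are played against each other: eliminating q leaves an equation between
    -- powers of p times integers, ready for `pow-compare`.
    cross-multiplied : ∀ {e} w′ u′ → q * fromℤ w′ ≡ pow e * fromℤ u′ →
      pow (k ℕ.+ e) * fromℤ (u′ ℤ.* w) ≡ pow l * fromℤ (u ℤ.* w′)
    cross-multiplied {e} w′ u′ eq′ = begin
      pow (k ℕ.+ e) * fromℤ (u′ ℤ.* w)           ≡⟨ cong₂ _*_ (pow-+ k e) (fromℤ-* u′ w) ⟩
      (pow k * pow e) * (fromℤ u′ * fromℤ w)     ≡⟨ regroup₁ (pow k) (pow e) (fromℤ u′) (fromℤ w) ⟩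
      pow k * (pow e * fromℤ u′) * fromℤ w       ≡⟨ cong (λ r → pow k * r * fromℤ w) eq′ ⟨
      pow k * (q * fromℤ w′) * fromℤ w           ≡⟨ regroup₂ (pow k) q (fromℤ w′) (fromℤ w) ⟩
      (pow k * q * fromℤ w) * fromℤ w′           ≡⟨ cong (_* fromℤ w′) eq ⟩
      pow l * fromℤ u * fromℤ w′                 ≡⟨ ℚ.*-assoc (pow l) (fromℤ u) (fromℤ w′) ⟩
      pow l * (fromℤ u * fromℤ w′)               ≡⟨ cong (pow l *_) (fromℤ-* u w′) ⟨
      pow l * fromℤ (u ℤ.* w′)                   ∎
      where
      open ≡-Reasoning
      regroup₁ : ∀ a b c d → (a * b) * (c * d) ≡ a * (b * c) * d
      regroup₁ = solve-∀ ℚ-ring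
      regroup₂ : ∀ a b c d → a * (b * c) * d ≡ (a * b * d) * c
      regroup₂ = solve-∀ ℚ-ring

    Val≥⇒≤ : ∀ {e} → Val≥ e q → k ℕ.+ e ≤ l
    Val≥⇒≤ {e} (val≥ w′ u′ p∤w′ eq′) =
      pow-compare (u′ ℤ.* w) (u ℤ.* w′) (unit-* u w′ p∤u p∤w′) (cross-multiplied w′ u′ eq′)

    Val≡⇒≡ : ∀ {e} → Val≡ e q → k ℕ.+ e ≡ l
    Val≡⇒≡ {e} h@(val≡ w′ u′ _ p∤u′ eq′) =
      ℕ.≤-antisym (Val≥⇒≤ (Val≡⇒Val≥ h))
        (pow-compare (u ℤ.* w′) (u′ ℤ.* w) (unit-* u′ w p∤u′ p∤w) (sym (cross-multiplied w′ u′ eq′)))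

-- Powers as a substitute for the logarithm

n<m^n : ∀ {m} → 2 ≤ m → ∀ n → n ℕ.< m ℕ.^ n
n<m^n         2≤m zero    = ℕ.s≤s ℕ.z≤n
n<m^n {m} 2≤m (suc n) = begin
  2 ℕ.+ n              ≤⟨ ℕ.+-monoʳ-≤ 2 (ℕ.m≤n*m n 2) ⟩
  2 ℕ.+ 2 ℕ.* n        ≡⟨ ℕ.*-suc 2 n ⟨
  2 ℕ.* suc n          ≤⟨ ℕ.*-mono-≤ 2≤m (n<m^n 2≤m n) ⟩
  m ℕ.* m ℕ.^ n        ∎
  where open ℕ.≤-Reasoning

-- k is the integer part of the logarithm of (2 + n)/2 to base m.
bracket-by-powers : ∀ {m} → 2 ≤ m → ∀ n → ∃ λ k → 2 ℕ.* m ℕ.^ k ≤ 2 ℕ.+ n × 2 ℕ.+ n ℕ.< 2 ℕ.* m ℕ.^ suc k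
bracket-by-powers {m} 2≤m zero = 0 , ℕ.≤-refl , (begin
  3                    ≤⟨ ℕ.n≤1+n 3 ⟩
  2 ℕ.* 2              ≤⟨ ℕ.*-monoʳ-≤ 2 2≤m ⟩
  2 ℕ.* m              ≡⟨ cong (2 ℕ.*_) (ℕ.*-identityʳ m) ⟨
  2 ℕ.* (m ℕ.* 1)      ∎)
  where open ℕ.≤-Reasoning
bracket-by-powers {m} 2≤m (suc n) with bracket-by-powers 2≤m n
... | k , lower , upper with ℕ.<-≤-connex (3 ℕ.+ n) (2 ℕ.* m ℕ.^ suc k)
...   | inj₁ below = k , ℕ.m≤n⇒m≤1+n lower , below
...   | inj₂ above = suc k , above , (begin-strict
  3 ℕ.+ n                          ≤⟨ upper ⟩
  2 ℕ.* m ℕ.^ suc k                <⟨ ℕ.*-monoʳ-< 2 (ℕ.^-monoʳ-< m 2≤m (ℕ.n<1+n (suc k))) ⟩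
  2 ℕ.* m ℕ.^ suc (suc k)          ∎)
  where open ℕ.≤-Reasoning

-- Positivity of the truncated logarithm

∑-nonneg : ∀ N {f} → (∀ i → 0ℚ ≤ℚ f i) → 0ℚ ≤ℚ ∑ N f
∑-nonneg zero    0≤f = ℚ.≤-refl
∑-nonneg (suc N) 0≤f = ℚ.+-mono-≤ (0≤f 0) (∑-nonneg N (λ i → 0≤f (suc i)))

∑-pos : ∀ {N f} j → j ℕ.< N → 0ℚ <ℚ f j → (∀ i → 0ℚ ≤ℚ f i) → 0ℚ <ℚ ∑ N f
∑-pos {suc N} zero    _             0<fj 0≤f = ℚ.+-mono-<-≤ 0<fj (∑-nonneg N (λ i → 0≤f (suc i)))
∑-pos {suc N} (suc j) (ℕ.s≤s j<N) 0<fj 0≤f = ℚ.+-mono-≤-< (0≤f 0) (∑-pos j j<N 0<fj (λ i → 0≤f (suc i)))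

1/suc-pos : ∀ i → 0ℚ <ℚ 1/suc i
1/suc-pos i = ℚ.positive⁻¹ (1/suc i) {{ℚ.normalize-pos 1 (suc i)}}

logTerm-pos : ∀ {w} → 0ℚ <ℚ w → ∀ i → 0ℚ <ℚ logTerm w i
logTerm-pos 0<w i = *-pos (pos-^ℚ 0<w (suc i)) (1/suc-pos i)

-- All summands are nonnegative, and the one with i = m is positive because its coefficient is 1 by
-- `κ-diagonal`.
partialLog-pos : ∀ {w N m} → 0ℚ <ℚ w → m ℕ.< N → 0ℚ <ℚ partialLog w N m
partialLog-pos {w} {N} {m} 0<w m<N = ∑-pos m m<N
  (subst (0ℚ <ℚ_) (sym (trans (cong (λ c → fromℕ c * logTerm w m) (κ-diagonal m)) (ℚ.*-identityˡ (logTerm w m)))) (logTerm-pos 0<w m))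
  (λ i → ℚ.nonNegative⁻¹ _ {{ℚ.nonNeg*nonNeg⇒nonNeg (fromℕ (κ i m)) {{nonNegative (fromℤ-mono-≤ {+ 0} {+ κ i m} (ℤ.+≤+ ℕ.z≤n))}}
                                (logTerm w i) {{nonNegative (ℚ.<⇒≤ (logTerm-pos 0<w i))}}}})

-- Valuation of the truncated logarithm

module _ {p : ℕ} (p-prime : Prime p) where
  open Valuation p-prime

  2≤p : 2 ≤ p
  2≤p = ℕ.nonTrivial⇒n>1 p {{prime⇒nonTrivial p-prime}}

  split-prime-power : ∀ n → n ≢ 0 → Σ ℕ λ v → Σ ℕ λ m → n ≡ p ℕ.^ v ℕ.* m × Unit (+ m)
  split-prime-power = <-rec _ split
    where
    split : ∀ n → (∀ {k} → k ℕ.< n → k ≢ 0 → Σ ℕ λ v → Σ ℕ λ m → k ≡ p ℕ.^ v ℕ.* m × Unit (+ m)) →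
            n ≢ 0 → Σ ℕ λ v → Σ ℕ λ m → n ≡ p ℕ.^ v ℕ.* m × Unit (+ m)
    split n rec n≢0 with p ∣? n
    ... | no p∤n = 0 , n , sym (ℕ.+-identityʳ n) , p∤n
    ... | yes (divides zero n≡0) = contradiction n≡0 n≢0
    ... | yes (divides k@(suc _) refl) with rec (ℕ.m<m*n k p 2≤p) (λ ())
    ...   | v , m , eq , p∤m = suc v , m , trans (cong (ℕ._* p) eq) (rotate (p ℕ.^ v) m p) , p∤m
      where
      rotate : ∀ a b c → a ℕ.* b ℕ.* c ≡ c ℕ.* a ℕ.* b
      rotate = ℕ-Solver.solve-∀

  -- An integer form of the monotonicity of x ↦ 2x - log_p x.
  exponent-bound : ∀ {M α t v} → M ℕ.< 2 ℕ.* p ℕ.^ suc α → p ℕ.^ v ≤ t → M ≤ 2 ℕ.* t → M ℕ.+ v ≤ 2 ℕ.* t ℕ.+ α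
  exponent-bound {M} {α} {t} {v} M< p^v≤t M≤2t with ℕ.<-≤-connex α v
  ... | inj₂ v≤α = ℕ.+-mono-≤ M≤2t v≤α
  ... | inj₁ α<v with ℕ.m≤n⇒∃[o]m+o≡n α<v
  -- For v = α + 1 + d the claim is M + 1 + d ≤ 2t. It follows from 2t ≥ 2 p^(α + 1) p^d ≥ (M + 1)
  -- (d + 1), since p^d > d.
  ...   | d , refl = begin
    M ℕ.+ (suc α ℕ.+ d)                           ≡⟨ regroup M α d ⟩
    (suc M ℕ.+ d) ℕ.+ α                           ≤⟨ ℕ.+-monoˡ-≤ α (begin
      suc M ℕ.+ d                                   ≤⟨ ℕ.+-monoʳ-≤ (suc M) (ℕ.m≤m*n d (suc M)) ⟩
      suc M ℕ.+ d ℕ.* suc M                         ≡⟨ ℕ.*-comm (suc d) (suc M) ⟩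
      suc M ℕ.* suc d                               ≤⟨ ℕ.*-mono-≤ M< (n<m^n 2≤p d) ⟩
      2 ℕ.* p ℕ.^ suc α ℕ.* p ℕ.^ d                 ≡⟨ ℕ.*-assoc 2 (p ℕ.^ suc α) (p ℕ.^ d) ⟩
      2 ℕ.* (p ℕ.^ suc α ℕ.* p ℕ.^ d)               ≡⟨ cong (2 ℕ.*_) (ℕ.^-distribˡ-+-* p (suc α) d) ⟨
      2 ℕ.* p ℕ.^ (suc α ℕ.+ d)                     ≤⟨ ℕ.*-monoʳ-≤ 2 p^v≤t ⟩
      2 ℕ.* t                                       ∎) ⟩
    2 ℕ.* t ℕ.+ α                                 ∎
    where
    open ℕ.≤-Reasoning
    regroup : ∀ M α d → M ℕ.+ (suc α ℕ.+ d) ≡ (suc M ℕ.+ d) ℕ.+ α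
    regroup = ℕ-Solver.solve-∀

  module _ {w : ℚ} {c : ℤ} (p∤c : Unit c) (wc≡-p² : w * fromℤ c ≡ - (fromℕ p * fromℕ p)) where

    logTerm-Val≡ : ∀ {i e v m} → suc i ≡ p ℕ.^ v ℕ.* m → Unit (+ m) → e ℕ.+ v ≡ 2 ℕ.* suc i → Val≡ e (logTerm w i)
    logTerm-Val≡ {i} {e} {v} {m} t≡ p∤m e+v≡2t =
      -- The witnesses come from wᵗ cᵗ = (-1)ᵗ p²ᵗ and m/t = p^(-v). Multiplying through by p^v lets
      -- p^v m = t cancel the denominator t.
      val≡ (c ℤ.^ t ℤ.* + m) (ℤ.-1ℤ ℤ.^ t)
        (unit-* (c ℤ.^ t) (+ m) (unit-^ c t p∤c) p∤m)
        (unit-^ ℤ.-1ℤ t unit-1)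
        (*-cancelˡ (pow≢0 v) (begin
          pow v * (w ^ℚ t * r * fromℤ (c ℤ.^ t ℤ.* + m))
            ≡⟨ cong (λ s → pow v * (w ^ℚ t * r * s)) (trans (fromℤ-* (c ℤ.^ t) (+ m)) (cong (_* fromℕ m) (fromℤ-^ c t))) ⟩
          pow v * (w ^ℚ t * r * (C ^ℚ t * fromℕ m))
            ≡⟨ regroup₁ (pow v) (w ^ℚ t) r (C ^ℚ t) (fromℕ m) ⟩
          (w ^ℚ t * C ^ℚ t) * ((pow v * fromℕ m) * r)
            ≡⟨ cong₂ (λ s u → s * (u * r)) (sym (^ℚ-distribʳ-* w C t)) (trans (sym (fromℕ-* (p ℕ.^ v) m)) (cong fromℕ (sym t≡))) ⟩
          (w * C) ^ℚ t * (fromℕ t * r)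
            ≡⟨ cong₂ (λ s u → s ^ℚ t * u) (trans wc≡-p² (neg (fromℕ p * fromℕ p))) (fromℕ-1/suc i) ⟩
          (fromℤ ℤ.-1ℤ * (fromℕ p * fromℕ p)) ^ℚ t * 1ℚ
            ≡⟨ ℚ.*-identityʳ _ ⟩
          (fromℤ ℤ.-1ℤ * (fromℕ p * fromℕ p)) ^ℚ t
            ≡⟨ trans (^ℚ-distribʳ-* (fromℤ ℤ.-1ℤ) (fromℕ p * fromℕ p) t) (cong₂ _*_ (sym (fromℤ-^ ℤ.-1ℤ t)) (^ℚ-distribʳ-* (fromℕ p) (fromℕ p) t)) ⟩
          fromℤ (ℤ.-1ℤ ℤ.^ t) * (fromℕ p ^ℚ t * fromℕ p ^ℚ t)
            ≡⟨ cong (fromℤ (ℤ.-1ℤ ℤ.^ t) *_) powers ⟩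
          fromℤ (ℤ.-1ℤ ℤ.^ t) * (pow e * pow v)
            ≡⟨ regroup₂ (fromℤ (ℤ.-1ℤ ℤ.^ t)) (pow e) (pow v) ⟩
          pow v * (pow e * fromℤ (ℤ.-1ℤ ℤ.^ t)) ∎))
      where
      open ≡-Reasoning
      t = suc i
      r = 1/suc i
      C = fromℤ c
      neg : ∀ q → - q ≡ - 1ℚ * q
      neg = solve-∀ ℚ-ring
      regroup₁ : ∀ a b c d e → a * (b * c * (d * e)) ≡ (b * d) * ((a * e) * c)
      regroup₁ = solve-∀ ℚ-ring
      regroup₂ : ∀ a b c → a * (b * c) ≡ c * (b * a)
      regroup₂ = solve-∀ ℚ-ring
      powers : fromℕ p ^ℚ t * fromℕ p ^ℚ t ≡ pow e * pow v
      powers = begin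
        fromℕ p ^ℚ t * fromℕ p ^ℚ t      ≡⟨ cong₂ _*_ (fromℤ-pos-^ p t) (fromℤ-pos-^ p t) ⟨
        pow t * pow t                    ≡⟨ pow-+ t t ⟨
        pow (t ℕ.+ t)                    ≡⟨ cong pow_ (trans e+v≡2t (cong (t ℕ.+_) (ℕ.+-identityʳ t))) ⟨
        pow (e ℕ.+ v)                    ≡⟨ pow-+ e v ⟩
        pow e * pow v                    ∎

    -- `e + α` takes the place of M in `exponent-bound`. Keeping it as a sum lets the equality case
    -- reuse the estimate with e raised by one.
    logTerm-Val≥ : ∀ {i e α} → e ℕ.+ α ℕ.< 2 ℕ.* p ℕ.^ suc α → e ℕ.+ α ≤ 2 ℕ.* suc i → Val≥ e (logTerm w i)
    logTerm-Val≥ {i} {e} {α} M< M≤2t with split-prime-power (suc i) (λ ())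
    ... | v , zero , _ , p∤0 = contradiction (divides 0 refl) p∤0
    ... | v , m@(suc _) , t≡ , p∤m = Val≥-weaken e≤f (Val≡⇒Val≥ (logTerm-Val≡ t≡ p∤m (ℕ.m∸n+n≡m v≤2t)))
      where
      open ℕ.≤-Reasoning
      f = 2 ℕ.* suc i ℕ.∸ v
      p^v≤t : p ℕ.^ v ≤ suc i
      p^v≤t = subst (p ℕ.^ v ≤_) (sym t≡) (ℕ.m≤m*n (p ℕ.^ v) m)
      v≤2t : v ≤ 2 ℕ.* suc i
      v≤2t = ℕ.≤-trans (ℕ.<⇒≤ (n<m^n 2≤p v)) (ℕ.≤-trans p^v≤t (ℕ.m≤n*m (suc i) 2))
      e≤f : e ≤ f
      e≤f = ℕ.+-cancelʳ-≤ (α ℕ.+ v) e f (begin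
        e ℕ.+ (α ℕ.+ v)                ≡⟨ ℕ.+-assoc e α v ⟨
        e ℕ.+ α ℕ.+ v                  ≤⟨ exponent-bound {α = α} {v = v} M< p^v≤t M≤2t ⟩
        2 ℕ.* suc i ℕ.+ α              ≡⟨ cong (ℕ._+ α) (ℕ.m∸n+n≡m v≤2t) ⟨
        f ℕ.+ v ℕ.+ α                  ≡⟨ ℕ.+-assoc f v α ⟩
        f ℕ.+ (v ℕ.+ α)                ≡⟨ cong (f ℕ.+_) (ℕ.+-comm v α) ⟩
        f ℕ.+ (α ℕ.+ v)                ∎)

    -- For m > 2i the coefficient vanishes, so the size condition m ≤ 2i may be assumed when
    -- estimating the logarithmic term.
    summand-Val≥ : ∀ {i m e} → (m ≤ 2 ℕ.* i → Val≥ e (logTerm w i)) → Val≥ e (fromℕ (κ i m) * logTerm w i)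
    summand-Val≥ {i} {m} {e} h with ℕ.<-≤-connex (2 ℕ.* i) m
    ... | inj₂ m≤2i = Val≥-scale (+ κ i m) (h m≤2i)
    ... | inj₁ 2i<m = subst (Val≥ e)
      (sym (trans (cong (λ k → fromℕ k * logTerm w i) (κ-high {i} 2i<m)) (ℚ.*-zeroˡ (logTerm w i)))) (Val≥-0 e)

    partialLog-Val≥ : ∀ {N m e α} → e ℕ.+ α ≡ 2 ℕ.+ m → 2 ℕ.+ m ℕ.< 2 ℕ.* p ℕ.^ suc α → Val≥ e (partialLog w N m)
    partialLog-Val≥ {N} {m} {e} {α} M≡ M< = Val≥-∑ N λ i → summand-Val≥ {i} {m} λ m≤2i →
      logTerm-Val≥ {i} {e} {α} (subst (ℕ._< 2 ℕ.* p ℕ.^ suc α) (sym M≡) M<)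
        (ℕ.≤-trans (ℕ.≤-reflexive M≡) (ℕ.≤-trans (ℕ.+-monoʳ-≤ 2 m≤2i) (ℕ.≤-reflexive (sym (ℕ.*-suc 2 i)))))

    partialLog-Val≡ : ∀ {N m e β} → e ℕ.+ β ≡ 2 ℕ.+ m → 2 ℕ.+ m ≡ 2 ℕ.* p ℕ.^ β → m ℕ.< N → Val≡ e (partialLog w N m)
    partialLog-Val≡ {N} {m} {e} {β} M≡ M≡2p^β m<N = Val≡-∑ j j<N
      (subst (Val≡ e) (sym (trans (cong (λ k → fromℕ k * logTerm w j) κ≡1) (ℚ.*-identityˡ (logTerm w j))))
        (logTerm-Val≡ {j} {e} {β} {1} (trans 1+j≡p^β (sym (ℕ.*-identityʳ (p ℕ.^ β)))) unit-1
          (trans M≡ (trans M≡2p^β (cong (2 ℕ.*_) (sym 1+j≡p^β))))))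
      -- Every other contributing i exceeds j, so 2 (i + 1) ≥ M + 2. The general estimate then
      -- applies with M + 1 in place of M and the same β, which yields one more factor p.
      (λ i i≢j → summand-Val≥ {i} {m} λ m≤2i → logTerm-Val≥ {i} {suc e} {β} M+1< (M+1≤ i i≢j m≤2i))
      where
      open ℕ.≤-Reasoning
      j = ℕ.pred (p ℕ.^ β)
      1+j≡p^β : suc j ≡ p ℕ.^ β
      1+j≡p^β = ℕ.suc-pred (p ℕ.^ β) {{ℕ.m^n≢0 p β}}
      m≡2j : m ≡ 2 ℕ.* j
      m≡2j = ℕ.+-cancelˡ-≡ 2 m (2 ℕ.* j) (trans M≡2p^β (trans (cong (2 ℕ.*_) (sym 1+j≡p^β)) (ℕ.*-suc 2 j)))
      κ≡1 : κ j m ≡ 1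
      κ≡1 = trans (cong (κ j) m≡2j) (κ-top j)
      j<N : j ℕ.< N
      j<N = ℕ.≤-<-trans (ℕ.m≤n*m j 2) (subst (ℕ._< N) m≡2j m<N)
      -- The strict bound amounts to M + 2 ≤ 2 p^(β + 1), which is sharp for p = 2 and β = 0.
      M+1< : suc e ℕ.+ β ℕ.< 2 ℕ.* p ℕ.^ suc β
      M+1< = begin
        2 ℕ.+ (e ℕ.+ β)                             ≡⟨ ℕ.+-comm 2 (e ℕ.+ β) ⟩
        e ℕ.+ β ℕ.+ 2                               ≡⟨ cong (ℕ._+ 2) (trans M≡ M≡2p^β) ⟩
        2 ℕ.* p ℕ.^ β ℕ.+ 2                         ≤⟨ ℕ.+-monoʳ-≤ (2 ℕ.* p ℕ.^ β) (ℕ.*-monoʳ-≤ 2 (ℕ.m^n>0 p β)) ⟩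
        2 ℕ.* p ℕ.^ β ℕ.+ 2 ℕ.* p ℕ.^ β             ≡⟨ double (p ℕ.^ β) ⟩
        2 ℕ.* (2 ℕ.* p ℕ.^ β)                       ≤⟨ ℕ.*-monoʳ-≤ 2 (ℕ.*-monoˡ-≤ (p ℕ.^ β) 2≤p) ⟩
        2 ℕ.* p ℕ.^ suc β                           ∎
        where
        double : ∀ a → 2 ℕ.* a ℕ.+ 2 ℕ.* a ≡ 2 ℕ.* (2 ℕ.* a)
        double = ℕ-Solver.solve-∀
      M+1≤ : ∀ i → i ≢ j → m ≤ 2 ℕ.* i → suc e ℕ.+ β ≤ 2 ℕ.* suc i
      M+1≤ i i≢j m≤2i = begin
        suc (e ℕ.+ β)              ≡⟨ cong suc M≡ ⟩
        3 ℕ.+ m                    ≤⟨ ℕ.n≤1+n (3 ℕ.+ m) ⟩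
        4 ℕ.+ m                    ≡⟨ cong (4 ℕ.+_) m≡2j ⟩
        4 ℕ.+ 2 ℕ.* j              ≡⟨ cong (2 ℕ.+_) (ℕ.*-suc 2 j) ⟨
        2 ℕ.+ 2 ℕ.* suc j          ≡⟨ ℕ.*-suc 2 (suc j) ⟨
        2 ℕ.* suc (suc j)          ≤⟨ ℕ.*-monoʳ-≤ 2 (ℕ.s≤s j<i) ⟩
        2 ℕ.* suc i                ∎
        where
        j<i : j ℕ.< i
        j<i = ℕ.≤∧≢⇒< (ℕ.*-cancelˡ-≤ 2 (subst (_≤ 2 ℕ.* i) m≡2j m≤2i)) (λ eq → i≢j (sym eq))

-- Signs and positive inverses

sgn : ℕ → ℤ
sgn k = ℤ.-1ℤ ℤ.^ k

sgn-square : ∀ k → fromℤ (sgn k) * fromℤ (sgn k) ≡ 1ℚ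
sgn-square k = begin
  fromℤ (sgn k) * fromℤ (sgn k)                      ≡⟨ cong₂ _*_ (fromℤ-^ ℤ.-1ℤ k) (fromℤ-^ ℤ.-1ℤ k) ⟩
  fromℤ ℤ.-1ℤ ^ℚ k * fromℤ ℤ.-1ℤ ^ℚ k                ≡⟨ ^ℚ-distribʳ-* (fromℤ ℤ.-1ℤ) (fromℤ ℤ.-1ℤ) k ⟨
  1ℚ ^ℚ k                                            ≡⟨ 1^ℚ k ⟩
  1ℚ                                                 ∎
  where open ≡-Reasoning

pos-cancelʳ : ∀ {q r} → 0ℚ <ℚ r → 0ℚ <ℚ q * r → 0ℚ <ℚ q
pos-cancelʳ {q} {r} 0<r 0<qr =
  ℚ.*-cancelʳ-<-nonNeg r {{nonNegative (ℚ.<⇒≤ 0<r)}} (subst (_<ℚ q * r) (sym (ℚ.*-zeroˡ r)) 0<qr)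

inv-pos : ∀ {q} → 0ℚ <ℚ q → 0ℚ <ℚ inv q
inv-pos {q} 0<q = pos-cancelʳ 0<q (subst (0ℚ <ℚ_) (trans (sym (inv-inverseʳ (λ eq → ℚ.<⇒≢ 0<q (sym eq)))) (ℚ.*-comm q (inv q)))
  (fromℤ-mono-< {+ 0} {+ 1} (ℤ.+<+ (ℕ.s≤s ℕ.z≤n))))

-- The sum as a signed truncated logarithm

module ClosedForm {p : ℕ} (p-prime : Prime p) (a : ℤ) (p∤a : ¬ (+ p ∣ℤ a)) where
  open Valuation p-prime

  b : ℤ
  b = + p ℤ.- a

  p∤b : Unit b
  p∤b p∣b = unit-neg a p∤a (Signed.∣⇒∣ᵤ (Signed.∣m+n∣m⇒∣n {+ p} {+ p} {ℤ.- a} (Signed.∣ᵤ⇒∣ p∣b) Signed.∣-refl))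

  unit≢0 : ∀ z → Unit z → fromℤ z ≢ 0ℚ
  unit≢0 z p∤z eq = p∤z (subst (λ z → p ∣ ∣ z ∣) (sym (fromℤ-injective {z} {+ 0} eq)) (divides 0 refl))

  P A′ B′ A B x y w : ℚ
  P  = fromℕ p
  A′ = fromℤ a
  B′ = fromℤ b
  A  = inv A′
  B  = inv B′
  x  = - (P * A)
  y  = - (P * B)
  w  = x + y

  A′A≡1 : A′ * A ≡ 1ℚ
  A′A≡1 = inv-inverseʳ (unit≢0 a p∤a)

  B′B≡1 : B′ * B ≡ 1ℚ
  B′B≡1 = inv-inverseʳ (unit≢0 b p∤b)

  A′+B′≡P : A′ + B′ ≡ P
  A′+B′≡P = trans (sym (fromℤ-+ a b)) (cong fromℤ (cancel (+ p) a))
    where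
    cancel : ∀ p a → a ℤ.+ (p ℤ.- a) ≡ p
    cancel = ℤ-Solver.solve-∀

  P>0 : 0ℚ <ℚ P
  P>0 = fromℤ-mono-< {+ 0} {+ p} (ℤ.+<+ (ℕ.>-nonZero⁻¹ p))

  -- The choice b = p - a enters here: a + b = p gives 1/a + 1/b = p/(a b), so sum and product of x
  -- and y agree up to sign.
  xy≡-w : x * y ≡ - w
  xy≡-w = begin
    x * y                                               ≡⟨ regroup₁ P A B ⟩
    P * (P * (A * B))                                   ≡⟨ cong (λ s → P * (s * (A * B))) A′+B′≡P ⟨
    P * ((A′ + B′) * (A * B))                           ≡⟨ regroup₂ P A′ B′ A B ⟩
    P * ((A′ * A) * B + (B′ * B) * A)                   ≡⟨ cong₂ (λ s t → P * (s * B + t * A)) A′A≡1 B′B≡1 ⟩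
    P * (1ℚ * B + 1ℚ * A)                               ≡⟨ regroup₃ P A B ⟩
    - w                                                 ∎
    where
    open ≡-Reasoning
    regroup₁ : ∀ P A B → - (P * A) * - (P * B) ≡ P * (P * (A * B))
    regroup₁ = solve-∀ ℚ-ring
    regroup₂ : ∀ P A′ B′ A B → P * ((A′ + B′) * (A * B)) ≡ P * ((A′ * A) * B + (B′ * B) * A)
    regroup₂ = solve-∀ ℚ-ring
    regroup₃ : ∀ P A B → P * (1ℚ * B + 1ℚ * A) ≡ - (- (P * A) + - (P * B))
    regroup₃ = solve-∀ ℚ-ring

  wA′B′≡-P² : w * (A′ * B′) ≡ - (P * P)
  wA′B′≡-P² = begin
    w * (A′ * B′)                                       ≡⟨ regroup₁ P A′ B′ A B ⟩
    - (P * ((A′ * A) * B′ + (B′ * B) * A′))             ≡⟨ cong₂ (λ s t → - (P * (s * B′ + t * A′))) A′A≡1 B′B≡1 ⟩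
    - (P * (1ℚ * B′ + 1ℚ * A′))                         ≡⟨ regroup₂ P A′ B′ ⟩
    - (P * (A′ + B′))                                   ≡⟨ cong (λ s → - (P * s)) A′+B′≡P ⟩
    - (P * P)                                           ∎
    where
    open ≡-Reasoning
    regroup₁ : ∀ P A′ B′ A B → (- (P * A) + - (P * B)) * (A′ * B′) ≡ - (P * ((A′ * A) * B′ + (B′ * B) * A′))
    regroup₁ = solve-∀ ℚ-ring
    regroup₂ : ∀ P A′ B′ → - (P * (1ℚ * B′ + 1ℚ * A′)) ≡ - (P * (A′ + B′))
    regroup₂ = solve-∀ ℚ-ring

  signed-power : ∀ Q k → (- (P * Q)) ^ℚ k ≡ fromℤ (sgn k) * (P ^ℚ k * Q ^ℚ k)
  signed-power Q k = begin
    (- (P * Q)) ^ℚ k                              ≡⟨ cong (_^ℚ k) (neg (P * Q)) ⟩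
    (fromℤ ℤ.-1ℤ * (P * Q)) ^ℚ k                  ≡⟨ ^ℚ-distribʳ-* (fromℤ ℤ.-1ℤ) (P * Q) k ⟩
    fromℤ ℤ.-1ℤ ^ℚ k * (P * Q) ^ℚ k               ≡⟨ cong₂ _*_ (sym (fromℤ-^ ℤ.-1ℤ k)) (^ℚ-distribʳ-* P Q k) ⟩
    fromℤ (sgn k) * (P ^ℚ k * Q ^ℚ k)             ∎
    where
    open ≡-Reasoning
    neg : ∀ q → - q ≡ - 1ℚ * q
    neg = solve-∀ ℚ-ring

  term-inverses : ∀ j → term p a j ≡ (A ^ℚ suc j + B ^ℚ suc j) * (P ^ℚ suc j * 1/suc j)
  term-inverses j = cong₂ _*_
    (cong₂ _+_ (trans (cong inv (fromℤ-^ a (suc j))) (inv-^ (unit≢0 a p∤a) (suc j)))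
               (trans (cong inv (fromℤ-^ b (suc j))) (inv-^ (unit≢0 b p∤b) (suc j))))
    (trans (/-1/suc (+ (p ℕ.^ suc j)) j) (cong (_* 1/suc j) (fromℤ-pos-^ p (suc j))))

  term-roots : ∀ j → term p a j ≡ fromℤ (sgn (suc j)) * ((x ^ℚ suc j + y ^ℚ suc j) * 1/suc j)
  term-roots j = sym (begin
    s * ((x ^ℚ k + y ^ℚ k) * r)
      ≡⟨ cong₂ (λ q q′ → s * ((q + q′) * r)) (signed-power A k) (signed-power B k) ⟩
    s * ((s * (P ^ℚ k * A ^ℚ k) + s * (P ^ℚ k * B ^ℚ k)) * r)
      ≡⟨ regroup s (P ^ℚ k) (A ^ℚ k) (B ^ℚ k) r ⟩
    (s * s) * ((A ^ℚ k + B ^ℚ k) * (P ^ℚ k * r))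
      ≡⟨ cong (_* ((A ^ℚ k + B ^ℚ k) * (P ^ℚ k * r))) (sgn-square k) ⟩
    1ℚ * ((A ^ℚ k + B ^ℚ k) * (P ^ℚ k * r))
      ≡⟨ ℚ.*-identityˡ _ ⟩
    (A ^ℚ k + B ^ℚ k) * (P ^ℚ k * r)
      ≡⟨ term-inverses j ⟨
    term p a j ∎)
    where
    open ≡-Reasoning
    k = suc j
    s = fromℤ (sgn k)
    r = 1/suc j
    regroup : ∀ s P A B r → s * ((s * (P * A) + s * (P * B)) * r) ≡ (s * s) * ((A + B) * (P * r))
    regroup = solve-∀ ℚ-ring

  -- The alternating sign turns the two-term relation of `partialLog-step` into a telescoping sum.
  S≡partialLog : ∀ {N} m → m ℕ.< N → S p a (suc m) ≡ fromℤ (sgn (suc m)) * partialLog w N m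
  S≡partialLog {suc N} zero _ = begin
    0ℚ + term p a 0                                        ≡⟨ ℚ.+-identityˡ (term p a 0) ⟩
    term p a 0                                             ≡⟨ term-roots 0 ⟩
    fromℤ (sgn 1) * ((x ^ℚ 1 + y ^ℚ 1) * 1ℚ)               ≡⟨ cong (fromℤ (sgn 1) *_) (ℚ.*-identityʳ (x ^ℚ 1 + y ^ℚ 1)) ⟩
    fromℤ (sgn 1) * (x ^ℚ 1 + y ^ℚ 1)                      ≡⟨ cong (fromℤ (sgn 1) *_) (partialLog-0 {x} {y} refl xy≡-w N) ⟨
    fromℤ (sgn 1) * partialLog w (suc N) 0                 ∎
    where open ≡-Reasoning
  S≡partialLog {N} (suc m) m<N = begin
    S p a (suc m) + term p a (suc m)
      ≡⟨ cong₂ _+_ (S≡partialLog m (ℕ.<-trans (ℕ.n<1+n m) m<N)) (term-roots (suc m)) ⟩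
    s * F m + s′ * ((x ^ℚ suc (suc m) + y ^ℚ suc (suc m)) * 1/suc (suc m))
      ≡⟨ cong₂ (λ t u → s * F m + t * u) (fromℤ-* ℤ.-1ℤ (sgn (suc m))) (sym (partialLog-step {x} {y} refl xy≡-w m m<N)) ⟩
    s * F m + (- 1ℚ * s) * (F (suc m) + F m)
      ≡⟨ telescope s (F m) (F (suc m)) ⟩
    (- 1ℚ * s) * F (suc m)
      ≡⟨ cong (_* F (suc m)) (fromℤ-* ℤ.-1ℤ (sgn (suc m))) ⟨
    s′ * F (suc m) ∎
    where
    open ≡-Reasoning
    F = partialLog w N
    s  = fromℤ (sgn (suc m))
    s′ = fromℤ (sgn (suc (suc m)))
    telescope : ∀ s f g → s * f + (- 1ℚ * s) * (g + f) ≡ (- 1ℚ * s) * g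
    telescope = solve-∀ ℚ-ring

  -- Nonvanishing of the sum

  S-pos : 0ℚ <ℚ A′ → 0ℚ <ℚ B′ → ∀ m → 0ℚ <ℚ S p a (suc m)
  S-pos 0<A′ 0<B′ = S>0
    where
    0<A = inv-pos 0<A′
    0<B = inv-pos 0<B′
    term>0 : ∀ j → 0ℚ <ℚ term p a j
    term>0 j = subst (0ℚ <ℚ_) (sym (term-inverses j))
      (*-pos (ℚ.+-mono-< (pos-^ℚ 0<A (suc j)) (pos-^ℚ 0<B (suc j))) (*-pos (pos-^ℚ P>0 (suc j)) (1/suc-pos j)))
    S>0 : ∀ m → 0ℚ <ℚ S p a (suc m)
    S>0 zero    = subst (0ℚ <ℚ_) (sym (ℚ.+-identityˡ (term p a 0))) (term>0 0)
    S>0 (suc m) = ℚ.+-mono-< (S>0 m) (term>0 (suc m))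

  S≢0-of-w-pos : 0ℚ <ℚ w → ∀ m → S p a (suc m) ≢ 0ℚ
  S≢0-of-w-pos 0<w m S≡0 = ℚ.<⇒≢ (partialLog-pos {w} 0<w (ℕ.n<1+n m)) (sym (begin
    F                                      ≡⟨ ℚ.*-identityˡ F ⟨
    1ℚ * F                                 ≡⟨ cong (_* F) (sgn-square (suc m)) ⟨
    s * s * F                              ≡⟨ ℚ.*-assoc s s F ⟩
    s * (s * F)                            ≡⟨ cong (s *_) (S≡partialLog m (ℕ.n<1+n m)) ⟨
    s * S p a (suc m)                      ≡⟨ cong (s *_) S≡0 ⟩
    s * 0ℚ                                 ≡⟨ ℚ.*-zeroʳ s ⟩
    0ℚ                                     ∎))
    where
    open ≡-Reasoning
    F = partialLog w (suc m) m
    s = fromℤ (sgn (suc m))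

  -- w = p²/d. Passing d separately lets it be (-a) b or a (-b), whichever product has positive
  -- factors.
  w-pos : ∀ {d} → 0ℚ <ℚ d → d ≡ - (A′ * B′) → 0ℚ <ℚ w
  w-pos {d} 0<d d≡ = pos-cancelʳ 0<d (subst (0ℚ <ℚ_) (sym wd≡P²) (*-pos P>0 P>0))
    where
    open ≡-Reasoning
    *-neg : ∀ q r → q * - r ≡ - (q * r)
    *-neg = solve-∀ ℚ-ring
    neg-neg : ∀ q → - - q ≡ q
    neg-neg = solve-∀ ℚ-ring
    wd≡P² : w * d ≡ P * P
    wd≡P² = begin
      w * d                  ≡⟨ cong (w *_) d≡ ⟩
      w * - (A′ * B′)        ≡⟨ *-neg w (A′ * B′) ⟩
      - (w * (A′ * B′))      ≡⟨ cong -_ wA′B′≡-P² ⟩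
      - - (P * P)            ≡⟨ neg-neg (P * P) ⟩
      P * P                  ∎

  -- As a + b = p > 0, at most one of a and b is negative.
  complement-pos : ∀ {q r} → q + r ≡ P → q <ℚ 0ℚ → 0ℚ <ℚ - q × 0ℚ <ℚ r
  complement-pos {q} {r} q+r≡P q<0 = 0<-q , subst (0ℚ <ℚ_) (trans (cong (λ s → s + - q) (sym q+r≡P)) (cancel q r)) (ℚ.+-mono-< P>0 0<-q)
    where
    0<-q = ℚ.neg-antimono-< q<0
    cancel : ∀ q r → q + r + - q ≡ r
    cancel = solve-∀ ℚ-ring

  -- Outside the extremal case only a lower bound on the valuation is available, and 0 satisfies
  -- every such bound; the order of the rationals excludes 0 instead.
  S≢0 : ∀ m → S p a (suc m) ≢ 0ℚ
  S≢0 m = by-signs (ℚ.<-cmp A′ 0ℚ) (ℚ.<-cmp B′ 0ℚ)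
    where
    neg-*ˡ : ∀ q r → - q * r ≡ - (q * r)
    neg-*ˡ = solve-∀ ℚ-ring
    neg-*ʳ : ∀ q r → q * - r ≡ - (q * r)
    neg-*ʳ = solve-∀ ℚ-ring
    by-signs : Tri (A′ <ℚ 0ℚ) (A′ ≡ 0ℚ) (0ℚ <ℚ A′) → Tri (B′ <ℚ 0ℚ) (B′ ≡ 0ℚ) (0ℚ <ℚ B′) → S p a (suc m) ≢ 0ℚ
    by-signs (tri≈ _ A′≡0 _) _               = contradiction A′≡0 (unit≢0 a p∤a)
    by-signs _               (tri≈ _ B′≡0 _) = contradiction B′≡0 (unit≢0 b p∤b)
    by-signs (tri> _ _ 0<A′) (tri> _ _ 0<B′) = λ S≡0 → ℚ.<⇒≢ (S-pos 0<A′ 0<B′ m) (sym S≡0)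
    by-signs (tri< A′<0 _ _) _               =
      let 0<-A′ , 0<B′ = complement-pos A′+B′≡P A′<0
      in S≢0-of-w-pos (w-pos (*-pos 0<-A′ 0<B′) (neg-*ˡ A′ B′)) m
    by-signs (tri> _ _ 0<A′) (tri< B′<0 _ _) =
      let 0<-B′ , _ = complement-pos (trans (ℚ.+-comm B′ A′) A′+B′≡P) B′<0
      in S≢0-of-w-pos (w-pos (*-pos 0<A′ 0<-B′) (neg-*ʳ A′ B′)) m

  p∤ab : Unit (a ℤ.* b)
  p∤ab = unit-* a b p∤a p∤b

  w-ab : w * fromℤ (a ℤ.* b) ≡ - (P * P)
  w-ab = trans (cong (w *_) (fromℤ-* a b)) wA′B′≡-P²

  S-Val≥ : ∀ {m e α} → e ℕ.+ α ≡ 2 ℕ.+ m → 2 ℕ.+ m ℕ.< 2 ℕ.* p ℕ.^ suc α → Val≥ e (S p a (suc m))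
  S-Val≥ {m} {e} {α} M≡ M< = subst (Val≥ e) (sym (S≡partialLog m (ℕ.n<1+n m)))
    (Val≥-scale (sgn (suc m)) (partialLog-Val≥ p-prime {w} {a ℤ.* b} p∤ab w-ab {suc m} {α = α} M≡ M<))

  S-Val≡ : ∀ {m e β} → e ℕ.+ β ≡ 2 ℕ.+ m → 2 ℕ.+ m ≡ 2 ℕ.* p ℕ.^ β → Val≡ e (S p a (suc m))
  S-Val≡ {m} {e} {β} M≡ M≡2p^β = subst (Val≡ e) (sym (S≡partialLog m (ℕ.n<1+n m)))
    (Val≡-scale (sgn (suc m)) (unit-^ ℤ.-1ℤ (suc m) unit-1) (partialLog-Val≡ p-prime {w} {a ℤ.* b} p∤ab w-ab {suc m} {β = β} M≡ M≡2p^β (ℕ.n<1+n m)))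

-- From integer differences to natural numbers

pos-difference : ∀ {M l k j} → + M ℤ.- (l ℤ.⊖ k) ≡ + j → M ℕ.+ k ≡ l ℕ.+ j
pos-difference {M} {l} {k} {j} eq = ℤ.+-injective (begin
  + M ℤ.+ + k                                      ≡⟨ regroup (+ M) (+ l) (+ k) ⟩
  + l ℤ.+ (+ M ℤ.- (+ l ℤ.- + k))                  ≡⟨ cong (λ z → + l ℤ.+ (+ M ℤ.- z)) (ℤ.m-n≡m⊖n l k) ⟩
  + l ℤ.+ (+ M ℤ.- (l ℤ.⊖ k))                      ≡⟨ cong (λ z → + l ℤ.+ z) eq ⟩
  + l ℤ.+ + j                                      ∎)
  where
  open ≡-Reasoning
  regroup : ∀ M l k → M ℤ.+ k ≡ l ℤ.+ (M ℤ.- (l ℤ.- k))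
  regroup = ℤ-Solver.solve-∀

neg-difference : ∀ {M l k j} → + M ℤ.- (l ℤ.⊖ k) ≡ -[1+ j ] → M ℕ.+ k ℕ.+ suc j ≡ l
neg-difference {M} {l} {k} {j} eq = ℤ.+-injective (begin
  + M ℤ.+ + k ℤ.+ + suc j                                       ≡⟨ regroup (+ M) (+ l) (+ k) (+ suc j) ⟩
  + l ℤ.+ ((+ M ℤ.- (+ l ℤ.- + k)) ℤ.- -[1+ j ])                ≡⟨ cong (λ z → + l ℤ.+ ((+ M ℤ.- z) ℤ.- -[1+ j ])) (ℤ.m-n≡m⊖n l k) ⟩
  + l ℤ.+ ((+ M ℤ.- (l ℤ.⊖ k)) ℤ.- -[1+ j ])                    ≡⟨ cong (λ z → + l ℤ.+ (z ℤ.- -[1+ j ])) eq ⟩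
  + l ℤ.+ (-[1+ j ] ℤ.- -[1+ j ])                               ≡⟨ cong (λ z → + l ℤ.+ z) (ℤ.+-inverseʳ -[1+ j ]) ⟩
  + l ℤ.+ + 0                                                   ≡⟨ ℤ.+-identityʳ (+ l) ⟩
  + l                                                           ∎)
  where
  open ≡-Reasoning
  regroup : ∀ M l k j → M ℤ.+ k ℤ.+ j ≡ l ℤ.+ ((M ℤ.- (l ℤ.- k)) ℤ.- (ℤ.- j))
  regroup = ℤ-Solver.solve-∀

-- Comparing powers of p with M/2

module _ {p : ℕ} (p-prime : Prime p) (M : ℕ) where
  open Valuation p-prime
  open ≡-Reasoning

  half : ℚ
  half = + M / 2

  half-doubled : half * fromℕ 2 ≡ fromℕ M
  half-doubled = /-fromℤ (+ M) 2

  pow-doubled : ∀ j → (fromℕ p ^ℚ j) * fromℕ 2 ≡ fromℕ (2 ℕ.* p ℕ.^ j)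
  pow-doubled j = begin
    fromℕ p ^ℚ j * fromℕ 2           ≡⟨ cong (_* fromℕ 2) (fromℤ-pos-^ p j) ⟨
    pow j * fromℕ 2                  ≡⟨ ℚ.*-comm (pow j) (fromℕ 2) ⟩
    fromℕ 2 * pow j                  ≡⟨ fromℕ-* 2 (p ℕ.^ j) ⟨
    fromℕ (2 ℕ.* p ℕ.^ j)            ∎

  pow≤half : ∀ {j} → 2 ℕ.* p ℕ.^ j ≤ M → fromℕ p ^ℚ j ≤ℚ half
  pow≤half {j} 2p^j≤M = ℚ.*-cancelʳ-≤-pos (fromℕ 2)
    (subst₂ _≤ℚ_ (sym (pow-doubled j)) (sym half-doubled) (fromℤ-mono-≤ (ℤ.+≤+ 2p^j≤M)))

  pow≡half⇒ : ∀ {j} → fromℕ p ^ℚ j ≡ half → 2 ℕ.* p ℕ.^ j ≡ M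
  pow≡half⇒ {j} eq = ℤ.+-injective (fromℤ-injective (begin
    fromℕ (2 ℕ.* p ℕ.^ j)       ≡⟨ pow-doubled j ⟨
    fromℕ p ^ℚ j * fromℕ 2      ≡⟨ cong (_* fromℕ 2) eq ⟩
    half * fromℕ 2              ≡⟨ half-doubled ⟩
    fromℕ M                     ∎))

  ⇒pow≡half : ∀ {j} → 2 ℕ.* p ℕ.^ j ≡ M → fromℕ p ^ℚ j ≡ half
  ⇒pow≡half {j} eq = *-cancelˡ {fromℕ 2} (λ ()) (begin
    fromℕ 2 * fromℕ p ^ℚ j      ≡⟨ ℚ.*-comm (fromℕ 2) (fromℕ p ^ℚ j) ⟩
    fromℕ p ^ℚ j * fromℕ 2      ≡⟨ pow-doubled j ⟩
    fromℕ (2 ℕ.* p ℕ.^ j)       ≡⟨ cong fromℕ eq ⟩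
    fromℕ M                     ≡⟨ half-doubled ⟨
    half * fromℕ 2              ≡⟨ ℚ.*-comm half (fromℕ 2) ⟩
    fromℕ 2 * half              ∎)

  -- A negative power of p is below 1, and 1 ≤ M/2. Multiplying by 2 p^(j + 1) reduces this to
  -- natural numbers.
  inv-pow-<-half : ∀ {j} → 2 ≤ M → inv (fromℕ p ^ℚ suc j) <ℚ half
  inv-pow-<-half {j} 2≤M = ℚ.*-cancelʳ-<-nonNeg (Q * fromℕ 2) {{nonNegative (ℚ.<⇒≤ (*-pos (pow>0 (suc j)) 0<2))}}
    (subst₂ _<ℚ_ (sym lhs) (sym rhs) (fromℤ-mono-< (ℤ.+<+ 2<M*p^1+j)))
    where
    Q = pow suc j
    0<2 = fromℤ-mono-< {+ 0} {+ 2} (ℤ.+<+ (ℕ.s≤s ℕ.z≤n))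
    2<M*p^1+j : 2 ℕ.< M ℕ.* p ℕ.^ suc j
    2<M*p^1+j = ℕ.≤-trans (ℕ.n≤1+n 3) (ℕ.*-mono-≤ 2≤M (ℕ.*-mono-≤ (2≤p p-prime) (ℕ.m^n>0 p j)))
    regroup₁ : ∀ a b c → a * (b * c) ≡ (b * a) * c
    regroup₁ = solve-∀ ℚ-ring
    regroup₂ : ∀ a b c → a * (b * c) ≡ (a * c) * b
    regroup₂ = solve-∀ ℚ-ring
    lhs : inv (fromℕ p ^ℚ suc j) * (Q * fromℕ 2) ≡ fromℕ 2
    lhs = begin
      inv (fromℕ p ^ℚ suc j) * (Q * fromℕ 2)    ≡⟨ cong (λ q → inv q * (Q * fromℕ 2)) (fromℤ-pos-^ p (suc j)) ⟨
      inv Q * (Q * fromℕ 2)                     ≡⟨ regroup₁ (inv Q) Q (fromℕ 2) ⟩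
      (Q * inv Q) * fromℕ 2                     ≡⟨ cong (_* fromℕ 2) (inv-inverseʳ (pow≢0 (suc j))) ⟩
      1ℚ * fromℕ 2                              ≡⟨ ℚ.*-identityˡ (fromℕ 2) ⟩
      fromℕ 2                                   ∎
    rhs : half * (Q * fromℕ 2) ≡ fromℕ (M ℕ.* p ℕ.^ suc j)
    rhs = begin
      half * (Q * fromℕ 2)                      ≡⟨ regroup₂ half Q (fromℕ 2) ⟩
      (half * fromℕ 2) * Q                      ≡⟨ cong (_* Q) half-doubled ⟩
      fromℕ M * Q                               ≡⟨ fromℕ-* M (p ℕ.^ suc j) ⟨
      fromℕ (M ℕ.* p ℕ.^ suc j)                 ∎

-- The bound and its equality case

module _ {p : ℕ} (p-prime : Prime p) (a : ℤ) (p∤a : ¬ (+ p ∣ℤ a)) (m : ℕ) where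
  open Valuation p-prime
  open ClosedForm p-prime a p∤a using (S-Val≥; S-Val≡)

  M : ℕ
  M = 2 ℕ.+ m

  Extremal : Set
  Extremal = Σ ℕ (λ α → suc m ≡ 2 ℕ.* p ℕ.^ α ℕ.∸ 1)

  -- Truncated subtraction is genuine here because 2 p^β is nonzero.
  extremal⇒M≡ : ∀ β → suc m ≡ 2 ℕ.* p ℕ.^ β ℕ.∸ 1 → M ≡ 2 ℕ.* p ℕ.^ β
  extremal⇒M≡ β n≡ = trans (cong suc n≡) (ℕ.suc-pred (2 ℕ.* p ℕ.^ β) {{ℕ.m*n≢0 2 (p ℕ.^ β) {{_}} {{ℕ.m^n≢0 p β}}}})

  M∸α+α≡M : ∀ α → 2 ℕ.* p ℕ.^ α ≤ M → M ℕ.∸ α ℕ.+ α ≡ M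
  M∸α+α≡M α 2p^α≤M = ℕ.m∸n+n≡m
    (ℕ.≤-trans (ℕ.<⇒≤ (n<m^n (2≤p p-prime) α)) (ℕ.≤-trans (ℕ.m≤n*m (p ℕ.^ α) 2) 2p^α≤M))

  module _ (k l : ℕ) (w u : ℤ) (p∤w : Unit w) (p∤u : Unit u)
           (cleared : pow k * S p a (suc m) * fromℤ w ≡ pow l * fromℤ u) where

    -- For v = l - k this says M - v ≤ α without subtraction.
    exponent-upper : ∃ λ α → 2 ℕ.* p ℕ.^ α ≤ M × M ℕ.+ k ≤ l ℕ.+ α
    exponent-upper with bracket-by-powers (2≤p p-prime) m
    ... | α , lower , upper = α , lower , (begin
      M ℕ.+ k                     ≡⟨ cong (ℕ._+ k) (M∸α+α≡M α lower) ⟨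
      M ℕ.∸ α ℕ.+ α ℕ.+ k         ≡⟨ rotate (M ℕ.∸ α) α k ⟩
      k ℕ.+ (M ℕ.∸ α) ℕ.+ α       ≤⟨ ℕ.+-monoˡ-≤ α (Val≥⇒≤ k l w u p∤w p∤u cleared (S-Val≥ {α = α} (M∸α+α≡M α lower) upper)) ⟩
      l ℕ.+ α                     ∎)
      where
      open ℕ.≤-Reasoning
      rotate : ∀ a b c → a ℕ.+ b ℕ.+ c ≡ c ℕ.+ a ℕ.+ b
      rotate = ℕ-Solver.solve-∀

    exponent-extremal : ∀ {β} → M ≡ 2 ℕ.* p ℕ.^ β → M ℕ.+ k ≡ l ℕ.+ β
    exponent-extremal {β} M≡2p^β = begin
      M ℕ.+ k                     ≡⟨ cong (ℕ._+ k) e+β≡M ⟨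
      M ℕ.∸ β ℕ.+ β ℕ.+ k         ≡⟨ rotate (M ℕ.∸ β) β k ⟩
      k ℕ.+ (M ℕ.∸ β) ℕ.+ β       ≡⟨ cong (ℕ._+ β) (Val≡⇒≡ k l w u p∤w p∤u cleared (S-Val≡ {β = β} e+β≡M M≡2p^β)) ⟩
      l ℕ.+ β                     ∎
      where
      open ≡-Reasoning
      e+β≡M : M ℕ.∸ β ℕ.+ β ≡ M
      e+β≡M = M∸α+α≡M β (ℕ.≤-reflexive (sym M≡2p^β))
      rotate : ∀ a b c → a ℕ.+ b ℕ.+ c ≡ c ℕ.+ a ℕ.+ b
      rotate = ℕ-Solver.solve-∀

    -- d is a variable tied to M - v by an equation, so that matching on its sign lets `_^ℤ_`
    -- compute. For natural d the bound is the chain p^d ≤ p^α ≤ M/2.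
    valuation-bound : ∀ d → + M ℤ.- (l ℤ.⊖ k) ≡ d →
      (fromℤ (+ p) ^ℤ d ≤ℚ + M / 2) × ((fromℤ (+ p) ^ℤ d ≡ + M / 2) ⇔ Extremal)
    valuation-bound (+ j) eq = pow≤half p-prime M {j} 2p^j≤M , mk⇔ to from
      where
      M+k≡l+j : M ℕ.+ k ≡ l ℕ.+ j
      M+k≡l+j = pos-difference {M} {l} {k} eq
      2p^j≤M : 2 ℕ.* p ℕ.^ j ≤ M
      2p^j≤M = let α , 2p^α≤M , M+k≤l+α = exponent-upper in
        ℕ.≤-trans (ℕ.*-monoʳ-≤ 2 (ℕ.^-monoʳ-≤ p (ℕ.+-cancelˡ-≤ l j α (subst (_≤ l ℕ.+ α) M+k≡l+j M+k≤l+α)))) 2p^α≤M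
      -- Equality reads 2 p^j = M, so the exponent j itself is the required α.
      to : fromℤ (+ p) ^ℚ j ≡ + M / 2 → Extremal
      to pow≡half = j , sym (cong ℕ.pred (pow≡half⇒ p-prime M {j} pow≡half))
      from : Extremal → fromℤ (+ p) ^ℚ j ≡ + M / 2
      from (β , n≡) = ⇒pow≡half p-prime M {j} (trans (cong (λ e → 2 ℕ.* p ℕ.^ e) j≡β) (sym (extremal⇒M≡ β n≡)))
        where
        j≡β : j ≡ β
        j≡β = ℕ.+-cancelˡ-≡ l j β (trans (sym M+k≡l+j) (exponent-extremal (extremal⇒M≡ β n≡)))
    -- Here v > M. The inequality is strict, and n cannot be extremal, since that would force M - v
    -- = β ≥ 0.
    valuation-bound -[1+ j ] eq = ℚ.<⇒≤ below , mk⇔ (λ eq′ → contradiction eq′ (ℚ.<⇒≢ below)) from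
      where
      below : inv (fromℤ (+ p) ^ℚ suc j) <ℚ + M / 2
      below = inv-pow-<-half p-prime M {j} (ℕ.m≤m+n 2 m)
      M+k<l : M ℕ.+ k ℕ.< l
      M+k<l = subst (M ℕ.+ k ℕ.<_) (neg-difference {M} {l} {k} eq) (ℕ.m<m+n (M ℕ.+ k) (ℕ.s≤s ℕ.z≤n))
      from : Extremal → inv (fromℤ (+ p) ^ℚ suc j) ≡ + M / 2
      from (β , n≡) = contradiction (exponent-extremal (extremal⇒M≡ β n≡)) (ℕ.<⇒≢ (ℕ.<-≤-trans M+k<l (ℕ.m≤m+n l β)))

theorem1 : (p : ℕ) → Prime p → (a : ℤ) → ¬ (+ p ∣ℤ a) → (n : ℕ) → 1 ≤ n →
    (S p a n ≢ 0ℚ) ×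
    ((v : ℤ) → PadicVal p (S p a n) v →
    ((fromℤ (+ p) ^ℤ (+ suc n ℤ.- v)) ≤ℚ (+ suc n / 2)) ×
    (((fromℤ (+ p) ^ℤ (+ suc n ℤ.- v)) ≡ (+ suc n / 2))
    ⇔ Σ ℕ (λ α → n ≡ 2 ℕ.* p ℕ.^ α ℕ.∸ 1)))
theorem1 p p-prime a p∤a (suc m) _ = ClosedForm.S≢0 p-prime a p∤a m , λ v padic →
  let k , l , v≡ , w , u , p∤w , p∤u , cleared = Valuation.PadicVal-cleared p-prime {S p a (suc m)} {v} padic
  in valuation-bound p-prime a p∤a m k l w u p∤w p∤u cleared (+ suc (suc m) ℤ.- v) (cong (λ z → + suc (suc m) ℤ.- z) (sym v≡))
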